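{- Let $n\ge1$ and let $\Pi\subseteq\mathfrak{D}_n$ be invariant under the CMFS-action, i.e. $\tau^c_S(\sigma)\in\Pi$ for all $\sigma\in\Pi$ and all $S\subseteq[n]$. Let $A^{(\mathsf{cyc},\mathsf{exc})}(\Pi;w,t)=\sum_{\sigma\in\Pi}w^{\mathsf{cyc}\,\sigma}t^{\mathsf{exc}\,\sigma}$. Then $$A^{(\mathsf{cyc},\mathsf{exc})}(\Pi;w,t)=\left(\frac{1+xt}{1+x}\right)^{n}P^{(\mathsf{cyc},\mathsf{cpk},\mathsf{exc})}\left(\Pi;w,\frac{(1+x)^{2}t}{(x+t)(1+xt)},\frac{x+t}{1+xt}\right),$$ equivalently, $$P^{(\mathsf{cyc},\mathsf{cpk},\mathsf{exc})}(\Pi;w,x,t)=\left(\frac{1+u}{1+uv}\right)^{n}A^{(\mathsf{cyc},\mathsf{exc})}(\Pi;w,v),$$ where $u=\frac{1+t^{2}-2xt-(1-t)\sqrt{(1+t)^{2}-4xt}}{2(1-x)t}$ and $v=\frac{(1+t)^{2}-2xt-(1+t)\sqrt{(1+t)^{2}-4xt}}{2xt}$.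
   Context: $\mathfrak{D}_n$ is the set of derangements of $[n]$. $P^{(\mathsf{stat}_1,\ldots,\mathsf{stat}_m)}(\Omega;t_1,\ldots,t_m)=\sum_{\sigma\in\Omega}\prod_jt_j^{\mathsf{stat}_j\sigma}$; $\mathsf{cyc}$ = number of cycles, $\mathsf{exc}\,\sigma=\#\{i:\sigma(i)>i\}$, $\mathsf{cpk}\,\sigma=\#\{x:\sigma^{ -1}(x)<x>\sigma(x)\}$. Modified Foata–Strehl action: for a word $\rho$ of a permutation of $[n]$ with convention $\rho(0)=0,\rho(n+1)=\infty$ and $x\in[n]$, write $\rho=w_1w_2xw_3w_4$ where $w_2$ (resp. $w_3$) is the maximal contiguous factor immediately left (resp. right) of $x$ all of whose letters are smaller than $x$; $\varphi_x(\rho)=w_1w_3xw_2w_4$; $\varphi'_x(\rho)=\rho$ if $x$ is a peak of $\rho$ (i.e. its neighbors, with the convention, are both smaller) and $\varphi'_x(\rho)=\varphi_x(\rho)$ otherwise. For $\sigma\in\mathfrak{S}_n$, write each cycle starting with its largest element, order the cycles increasingly by their largest elements, and erase parentheses to get the word $\iota(\sigma)$ ($\iota$ is a bijection of $\mathfrak{S}_n$). For $\sigma\in\mathfrak{D}_n$, $\tau^c_x(\sigma)=\iota^{ -1}(\varphi'_x(\iota(\sigma)))$, and for $S\subseteq[n]$, $\tau^c_S=\prod_{x\in S}\tau^c_x$ (these commuting involutions of $\mathfrak{D}_n$ define the CMFS-action of $\mathbb{Z}_2^n$). -}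

module Defs where

open import Algebra.Bundles using (CommutativeRing)
import Algebra.Definitions
import Algebra.Properties.Semiring.Exp
open import Data.Bool.Base using (if_then_else_)
open import Data.Fin.Base using (Fin; _≤_; _<_)
open import Data.Fin.Permutation
  using (Permutation′; _⟨$⟩ʳ_; _⟨$⟩ˡ_; _≈_; id; _∘ₚ_; transpose)
open import Data.Fin.Properties using (_≟_; _≤?_; _<?_)
open import Data.Fin.Subset using (Subset)
open import Data.Fin.Subset.Properties using (_∈?_)
open import Data.List.Base as List
  using (List; []; _∷_; _++_; _∷ʳ_; map; concatMap; filter; foldr; length;
         allFin; iterate; takeWhile; dropWhile; reverse; head; last; drop)
open import Data.List.NonEmpty.Base as List⁺ using (List⁺; _∷_)
import Data.List.Membership.Setoid
open import Data.List.Relation.Unary.All as All using (All)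
import Data.List.Relation.Unary.Unique.Setoid
import Data.Maybe.Relation.Unary.All as Maybe-All
import Data.Maybe.Relation.Unary.Any as Maybe-Any
open import Data.Nat.Base using (ℕ)
open import Data.Product.Base using (_×_; proj₁)
open import Data.Vec.Base as Vec using (Vec; []; _∷_; zipWith)
open import Level using (0ℓ; _⊔_)
open import Relation.Binary.Bundles using (Setoid)
open import Relation.Binary.PropositionalEquality.Core
  using (_≢_; refl; sym; trans)
open import Relation.Nullary.Decidable using (Dec; does; ¬?; _×-dec_)
open import Relation.Unary using (Decidable)

private
  variable
    m n : ℕ

-- The letters 1 < … < n of [n] are the elements of Fin n, in the same
-- order.

permutationSetoid : ℕ → Setoid 0ℓ 0ℓ
permutationSetoid n = record
  { Carrier       = Permutation′ n
  ; _≈_           = _≈_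
  ; isEquivalence = record
    { refl  = λ _ → refl
    ; sym   = λ p i → sym (p i)
    ; trans = λ p q i → trans (p i) (q i)
    }
  }

-- A finite set of permutations is a duplicate-free list of them, both
-- membership and distinctness being taken up to pointwise equality.

module _ {n : ℕ} where
  open Data.List.Membership.Setoid (permutationSetoid n) public using (_∈_)
  open Data.List.Relation.Unary.Unique.Setoid (permutationSetoid n) public
    using (Unique)

Derangement : Permutation′ n → Set
Derangement σ = ∀ i → σ ⟨$⟩ʳ i ≢ i

-- n iterates suffice, as every cycle has length at most n.
cycleFrom : Permutation′ n → Fin n → List⁺ (Fin n)
cycleFrom {n} σ x =
  x ∷ takeWhile (λ y → ¬? (y ≟ x)) (iterate (σ ⟨$⟩ʳ_) (σ ⟨$⟩ʳ x) n)

StartsWithLargest : List⁺ (Fin n) → Set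
StartsWithLargest (x ∷ c) = All (_≤ x) c

startsWithLargest? : Decidable (StartsWithLargest {n})
startsWithLargest? (x ∷ c) = All.all? (_≤? x) c

-- allFin is increasing, so the cycles come out in increasing order of
-- their largest elements, each cycle exactly once.
cycles : Permutation′ n → List (List⁺ (Fin n))
cycles {n} σ = filter startsWithLargest? (map (cycleFrom σ) (allFin n))

Stat : ℕ → Set
Stat n = Permutation′ n → ℕ

cyc : Stat n
cyc σ = length (cycles σ)

exc : Stat n
exc {n} σ = length (filter (λ i → i <? σ ⟨$⟩ʳ i) (allFin n))

cpk : Stat n
cpk {n} σ =
  length (filter (λ x → (σ ⟨$⟩ˡ x <? x) ×-dec (σ ⟨$⟩ʳ x <? x)) (allFin n))

Word : ℕ → Set
Word n = List (Fin n)

ι : Permutation′ n → Word n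
ι σ = concatMap List⁺.toList (cycles σ)

-- blocks x c w: the word x c w cut in front of each left-to-right
-- maximum, where x is the current maximum and all letters of c are
-- smaller than x.
blocks : Fin n → Word n → Word n → List (List⁺ (Fin n))
blocks x c []      = (x ∷ c) ∷ []
blocks x c (y ∷ w) =
  if does (y <? x) then blocks x (c ∷ʳ y) w else (x ∷ c) ∷ blocks y [] w

-- The cycle x ↦ c₁ ↦ c₂ ↦ … ↦ x as (x c₁)(x c₂)⋯, the transpositions
-- being applied from left to right (which is the order of _∘ₚ_).
cycle : List⁺ (Fin n) → Permutation′ n
cycle (x ∷ c) = foldr (λ y π → transpose x y ∘ₚ π) id c

-- Since each cycle of σ starts with its largest element and these
-- increase, the left-to-right maxima of ι σ are the first letters of the
-- cycles.
ι⁻¹ : Word n → Permutation′ n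
ι⁻¹ []      = id
ι⁻¹ (x ∷ w) = foldr (λ b π → cycle b ∘ₚ π) id (blocks x [] w)

-- Below, x is assumed to occur in ρ (exactly once), as it does in the word
-- of a permutation.

leftOf : Fin n → Word n → Word n
leftOf x ρ = takeWhile (λ y → ¬? (y ≟ x)) ρ

rightOf : Fin n → Word n → Word n
rightOf x ρ = drop 1 (dropWhile (λ y → ¬? (y ≟ x)) ρ)

φ : Fin n → Word n → Word n
φ x ρ = w₁ ++ w₃ ++ x ∷ w₂ ++ w₄
  where
  w₁ = reverse (dropWhile (_<? x) (reverse (leftOf x ρ)))
  w₂ = reverse (takeWhile (_<? x) (reverse (leftOf x ρ)))
  w₃ = takeWhile (_<? x) (rightOf x ρ)
  w₄ = dropWhile (_<? x) (rightOf x ρ)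

-- A missing left neighbour is ρ(0) = 0 < x, whence All; a missing right
-- neighbour is ρ(n+1) = ∞ > x, whence Any.
Peak : Fin n → Word n → Set
Peak x ρ =
  Maybe-All.All (_< x) (last (leftOf x ρ)) ×
  Maybe-Any.Any (_< x) (head (rightOf x ρ))

peak? : (x : Fin n) (ρ : Word n) → Dec (Peak x ρ)
peak? x ρ =
  Maybe-All.dec (_<? x) (last (leftOf x ρ)) ×-dec
  Maybe-Any.dec (_<? x) (head (rightOf x ρ))

φ′ : Fin n → Word n → Word n
φ′ x ρ = if does (peak? x ρ) then ρ else φ x ρ

τᶜ : Fin n → Permutation′ n → Permutation′ n
τᶜ x σ = ι⁻¹ (φ′ x (ι σ))

-- The product is taken in the order of Fin n; on derangements the maps
-- τᶜ x commute.
τᶜ[_] : Subset n → Permutation′ n → Permutation′ n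
τᶜ[_] {n} S σ = foldr τᶜ σ (filter (_∈? S) (allFin n))

CMFS-Invariant : List (Permutation′ n) → Set
CMFS-Invariant {n} Π =
  ∀ (σ : Permutation′ n) → σ ∈ Π → ∀ (S : Subset n) → τᶜ[ S ] σ ∈ Π

-- Generating functions and rational expressions are evaluated at elements
-- of an arbitrary commutative ring R; a fraction requires its denominator
-- to be a unit. Taking for R a field containing indeterminates gives the
-- identities between formal expressions.

module Enumerators {c ℓ} (R : CommutativeRing c ℓ) where
  open CommutativeRing R hiding (_≈_)
  open Algebra.Definitions (CommutativeRing._≈_ R) using (Invertible)
  open Algebra.Properties.Semiring.Exp semiring public using (_^_)

  P : Vec (Stat n) m → List (Permutation′ n) → Vec Carrier m → Carrier
  P stats Ω ts = foldr _+_ 0# (map weight Ω)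
    where
    weight : Permutation′ _ → Carrier
    weight σ =
      Vec.foldr′ _*_ 1# (zipWith (λ stat t → t ^ stat σ) stats ts)

  A : List (Permutation′ n) → Carrier → Carrier → Carrier
  A Π w t = foldr _+_ 0# (map (λ σ → w ^ cyc σ * t ^ exc σ) Π)

  Unit : Carrier → Set (c ⊔ ℓ)
  Unit = Invertible 1# _*_

  infixl 7 _/_
  _/_ : (a b : Carrier) → ⦃ Unit b ⦄ → Carrier
  (a / b) ⦃ b-unit ⦄ = a * proj₁ b-unit

  2# 4# : Carrier
  2# = 1# + 1#
  4# = 2# + 2#

{-# OPTIONS --safe #-}
-- In a derangement every letter is a cyclic peak, a cyclic valley, a cyclic
-- double ascent or a cyclic double descent. Weight these four types by q₁,
-- q₂, d and e, multiply over the letters and by w ^ cyc, and sum over Π.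
-- Each permutation has as many cyclic peaks as cyclic valleys, so the sum
-- depends on q₁ and q₂ only through q₁ q₂; and τᶜ x is an involution of Π
-- which exchanges the two double types at x, keeping cyc and the types of
-- the other letters, so replacing the weights at one letter x after another
-- shows that the sum depends on d and e only through d + e. Up to the
-- factor cⁿ, both A and P are such sums, with (q₁, q₂, d, e) = c (1, t, t, 1)
-- and (x, t, t, 1), and both identities amount to the equality of the two
-- invariants.
--
-- ι and ι⁻¹ enter through the cycle decompositions IsCycles σ bs: σ has
-- exactly one, namely cycles σ, and τᶜ x moves x within one block of it.
module Submission where

-- If `x` is not the head of its block, the head `m` and all later heads exceed `x`, so the maximal
-- factors `w₂` and `w₃` of smaller letters around `x` stay inside the block. Hence `φ′ x`
-- rearranges a single tail, and the emptiness of `w₂` and `w₃` decides the type of `x`. A head is a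
-- peak, since a derangement has no block of one letter. At most three values of σ change, so the
-- types of the other letters can be compared arc by arc.
--
-- Equality of the two invariants means two equations for each identity. The first needs t = c² X T
-- and 1 + t = c (1 + T): writing 1 + t as (1 + x t) / (1 + x) plus (x + t) / (1 + x) gives c and c
-- T, and X is then forced. The second needs x t = c² v and 1 + t = c (1 + v): eliminating c leaves
-- x t (1 + v)² = (1 + t)² v, a quadratic in v with discriminant (1 + t)² ((1 + t)² - 4 x t). This
-- is where the radical of the statement comes from; it enters only through its square, so the
-- computation holds for every `s` with that square.

-- Orbits of a function, written as lists of letters.

module Paths where

  open import Data.Fin.Base using (Fin; toℕ)
  open import Data.Fin.Properties using (pigeonhole; toℕ<n)
  open import Data.List.Base
    using (List; []; _∷_; _++_; length; iterate; takeWhile)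
  open import Data.List.Membership.Propositional using (_∈_; _∉_)
  open import Data.List.Membership.Propositional.Properties using (∈-∃++)
  open import Data.List.Properties using (length-++)
  open import Data.List.Relation.Unary.All using ([]; _∷_)
  open import Data.List.Relation.Unary.All.Properties using (¬Any⇒All¬)
  open import Data.List.Relation.Unary.AllPairs using ([]; _∷_)
  open import Data.List.Relation.Unary.Any using (here; there)
  open import Data.List.Relation.Unary.Any.Properties using (++⁺ʳ)
  open import Data.List.Relation.Unary.Unique.Propositional using (Unique)
  open import Data.Nat.Base
    using (ℕ; zero; suc; _+_; _∸_; _≤_; _<_; s<s⁻¹; s≤s⁻¹)
  open import Data.Nat.Properties
    using (m∸n+n≡m; <⇒≤; m≤n+m; ≤-refl; ≤-trans; <-irrefl; m∸n≤m; m<n⇒0<n∸m)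
  open import Data.Product.Base using (_×_; _,_; proj₂)
  open import Data.Sum.Base using (_⊎_; inj₁; inj₂)
  open import Function.Base using (_∘_)
  open import Function.Definitions using (Injective)
  open import Relation.Binary.Construct.Closure.ReflexiveTransitive
    using (Star; ε; _◅_)
  open import Relation.Binary.Definitions using (DecidableEquality)
  open import Relation.Binary.PropositionalEquality
  open import Relation.Nullary using (yes; no; contradiction; ¬?)

  -- Both ends are kept outside the list, so that a cycle with head `x` and tail `c` is
  -- `Path f x c x`.
  Path : {A : Set} → (A → A) → A → List A → A → Set
  Path f a []      z = f a ≡ z
  Path f a (y ∷ l) z = f a ≡ y × Path f y l z

  lastOf : {A : Set} → A → List A → A
  lastOf a []      = a
  lastOf a (y ∷ l) = lastOf y l

  firstOf : {A : Set} → List A → A → A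
  firstOf []      z = z
  firstOf (y ∷ l) z = y

  module _ {A : Set} {f : A → A} where

    path-++⁻ : ∀ {a} l₁ {y l₂ z} →
               Path f a (l₁ ++ y ∷ l₂) z → Path f a l₁ y × Path f y l₂ z
    path-++⁻ []       (e , p) = e , p
    path-++⁻ (_ ∷ l₁) (e , p) = let q , r = path-++⁻ l₁ p in (e , q) , r

    path-last : ∀ {a} l {z} → Path f a l z → f (lastOf a l) ≡ z
    path-last []      e       = e
    path-last (_ ∷ l) (_ , p) = path-last l p

    path-first : ∀ {a} l {z} → Path f a l z → f a ≡ firstOf l z
    path-first []      e       = e
    path-first (_ ∷ l) (e , _) = e

    -- Both lists follow the same orbit, and as `z` occurs in neither, both end at the first arrival
    -- in `z`.
    path-deterministic : ∀ {a} l l′ {z} → Path f a l z → Path f a l′ z →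
                         z ∉ l → z ∉ l′ → l ≡ l′
    path-deterministic []      []       _       _       _   _    = refl
    path-deterministic []      (_ ∷ _)  refl    (e , _) _   z∉l′ =
      contradiction (here e) z∉l′
    path-deterministic (_ ∷ _) []       (e , _) refl    z∉l _    =
      contradiction (here e) z∉l
    path-deterministic (_ ∷ l) (_ ∷ l′) (refl , p) (refl , q) z∉l z∉l′ =
      cong (_ ∷_) (path-deterministic l l′ p q (z∉l ∘ there) (z∉l′ ∘ there))

    path-closed : ∀ {a} l {z y} → Path f a l z → y ∈ a ∷ l → f y ∈ l ⊎ f y ≡ z
    path-closed []      e          (here refl) = inj₂ e
    path-closed (_ ∷ l) (refl , _) (here refl) = inj₁ (here refl)
    path-closed (_ ∷ l) (_ , p)    (there y∈) with path-closed l p y∈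
    ... | inj₁ fy∈  = inj₁ (there fy∈)
    ... | inj₂ fy≡z = inj₂ fy≡z

    Reaches : A → A → Set
    Reaches = Star (λ a b → f a ≡ b)

    path-from : ∀ {a} l {z y} → Path f a l z → y ∈ a ∷ l → Reaches a y
    path-from l       p       (here refl) = ε
    path-from (_ ∷ l) (e , p) (there y∈)  = e ◅ path-from l p y∈

    path-to : ∀ {a} l {z y} → Path f a l z → y ∈ a ∷ l → Reaches y z
    path-to []      e       (here refl) = e ◅ ε
    path-to (_ ∷ l) (e , p) (here refl) = e ◅ path-to l p (here refl)
    path-to (_ ∷ l) (_ , p) (there y∈)  = path-to l p y∈

    -- Makes a cyclic path a whole orbit, on which the comparison of heads and the disjointness of
    -- blocks rest.
    cycle-closed : ∀ {x} c {y z} → Path f x c x → y ∈ x ∷ c → Reaches y z →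
                   z ∈ x ∷ c
    cycle-closed c p y∈ ε = y∈
    cycle-closed {x} c p y∈ (refl ◅ r) = cycle-closed c p (fy∈ (path-closed c p y∈)) r
      where
      fy∈ : ∀ {y} → f y ∈ c ⊎ f y ≡ x → f y ∈ x ∷ c
      fy∈ (inj₁ ∈c)  = there ∈c
      fy∈ (inj₂ e)   = here e

    -- A repeated letter would have two first-return words to z of different
    -- lengths.
    path-unique : ∀ {a} l {z} → Path f a l z → z ∉ l → Unique l
    path-unique []          p       z∉ = []
    path-unique {a} (y ∷ l) {z} (_ , p) z∉ =
      ¬Any⇒All¬ l y∉l ∷ path-unique l p (z∉ ∘ there)
      where
      y∉l : y ∉ l
      y∉l y∈l with l₁ , l₂ , refl ← ∈-∃++ y∈l =
        <-irrefl
          (cong length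
            (path-deterministic l₂ (l₁ ++ y ∷ l₂) (proj₂ (path-++⁻ l₁ p)) p
              (λ z∈ → z∉ (there (++⁺ʳ l₁ (there z∈)))) (z∉ ∘ there)))
          (subst (length l₂ <_) (sym (length-++ l₁))
            (m≤n+m _ (length l₁)))

    path-takeWhile : (_≟_ : DecidableEquality A) → ∀ {a z} N → z ∈ iterate f (f a) N →
                     Path f a (takeWhile (λ y → ¬? (y ≟ z)) (iterate f (f a) N)) z
    path-takeWhile _≟_ {a} {z} (suc N) z∈ with f a ≟ z | z∈
    ... | yes e | _         = e
    ... | no ¬e | here e    = contradiction (sym e) ¬e
    ... | no ¬e | there z∈′ = refl , path-takeWhile _≟_ N z∈′

  module _ {A : Set} {f g : A → A} where

    path-cong : ∀ {a} l {z} → (∀ {y} → y ∈ a ∷ l → f y ≡ g y) →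
                Path f a l z → Path g a l z
    path-cong []      f≗g e       = trans (sym (f≗g (here refl))) e
    path-cong (_ ∷ l) f≗g (e , p) =
      trans (sym (f≗g (here refl))) e , path-cong l (f≗g ∘ there) p

    -- With different endpoints two functions can differ on the path only at its last letter. This
    -- confines the effect of moving a letter within a cycle to the ends of the factors.
    path-agree-init : ∀ {a} l {z z′ y} → Path f a l z → Path g a l z′ →
                      y ∈ a ∷ l → y ≢ lastOf a l → f y ≡ g y
    path-agree-init []      _       _        (here refl) y≢ = contradiction refl y≢
    path-agree-init (_ ∷ l) (e , _) (e′ , _) (here refl) _  = trans e (sym e′)
    path-agree-init (_ ∷ l) (_ , p) (_ , p′) (there y∈)  y≢ =
      path-agree-init l p p′ y∈ y≢

    path-agree : ∀ {a} l {z y} → Path f a l z → Path g a l z →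
                 y ∈ a ∷ l → f y ≡ g y
    path-agree []      e       e′       (here refl) = trans e (sym e′)
    path-agree (_ ∷ l) (e , _) (e′ , _) (here refl) = trans e (sym e′)
    path-agree (_ ∷ l) (_ , p) (_ , p′) (there y∈)  = path-agree l p p′ y∈

  module _ {n : ℕ} {f : Fin n → Fin n} (f-injective : Injective _≡_ _≡_ f) where

    private
      pow : ℕ → Fin n → Fin n
      pow zero    a = a
      pow (suc k) a = pow k (f a)

      pow-injective : ∀ k → Injective _≡_ _≡_ (pow k)
      pow-injective zero    = λ e → e
      pow-injective (suc k) = f-injective ∘ pow-injective k

      pow-+ : ∀ k i a → pow (k + i) a ≡ pow i (pow k a)
      pow-+ zero    i a = refl
      pow-+ (suc k) i a = pow-+ k i (f a)

      pow∈iterate : ∀ {k N} a → k < N → pow k a ∈ iterate f a N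
      pow∈iterate {zero}  {suc N} a _   = here refl
      pow∈iterate {suc k} {suc N} a k<N = there (pow∈iterate (f a) (s<s⁻¹ k<N))

    -- Two of the n + 1 iterates with exponents 0 to n coincide; injectivity cancels the smaller
    -- exponent and leaves a period between 1 and n.
    ∈-iterate : ∀ x → x ∈ iterate f (f x) n
    ∈-iterate x with i , j , i<j , e ← pigeonhole ≤-refl (λ (i : Fin (suc n)) → pow (toℕ i) x) =
      from-period (toℕ j ∸ toℕ i) (m<n⇒0<n∸m i<j)
        (≤-trans (m∸n≤m (toℕ j) (toℕ i)) (s≤s⁻¹ (toℕ<n j)))
        (pow-injective (toℕ i)
          (trans (sym (pow-+ (toℕ j ∸ toℕ i) (toℕ i) x))
            (trans (cong (λ k → pow k x) (m∸n+n≡m (<⇒≤ i<j))) (sym e))))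
      where
      from-period : ∀ k → 0 < k → k ≤ n → pow k x ≡ x → x ∈ iterate f (f x) n
      from-period (suc k) _ k<n e =
        subst (_∈ iterate f (f x) n) e (pow∈iterate (f x) k<n)

-- Existence and uniqueness of the cycle decomposition.

module Cycles where

  open import Defs hiding (Unique; _∈_)
  open import Data.Fin.Base using (Fin; _≤_; _<_)
  open import Data.Fin.Permutation
    using (Permutation′; _⟨$⟩ʳ_; _⟨$⟩ˡ_; _≈_; inverseˡ)
  open import Data.Fin.Properties
    using (_≟_; ≤-antisym; ≤-refl; <-irrefl; <-asym; ≤∧≢⇒<; ≤-trans; ≤-total)
  open import Data.Nat.Properties using (<⇒≤; <-≤-trans)
  open import Data.List.Base
    using (List; []; _∷_; map; concatMap; allFin; iterate)
  open import Data.List.NonEmpty.Base as List⁺ using (List⁺; _∷_)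
  open import Data.List.Membership.Propositional using (_∈_; _∉_; find; lose)
  open import Data.List.Membership.Propositional.Properties
    using (∈-concatMap⁺; ∈-concatMap⁻; ∈-map⁺; ∈-filter⁺; ∈-allFin)
  open import Data.List.Relation.Binary.Disjoint.Propositional
    using (Disjoint)
  open import Data.List.Relation.Unary.All as All using (All; []; _∷_)
  import Data.List.Relation.Unary.All.Properties as All
  open import Data.List.Relation.Unary.AllPairs as AllPairs
    using (AllPairs; []; _∷_)
  import Data.List.Relation.Unary.AllPairs.Properties as AllPairs
  open import Data.List.Relation.Unary.Any using (here; there)
  open import Data.List.Relation.Unary.Unique.Propositional using (Unique)
  import Data.List.Relation.Unary.Unique.Propositional.Properties as Unique
  open import Data.Nat.Base using (ℕ)
  open import Data.Product.Base using (∃; _×_; _,_; uncurry)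
  open import Data.Sum.Base using (inj₁; inj₂)
  open import Function.Base using (_∘_; _on_)
  open import Function.Definitions using (Injective)
  open import Relation.Binary.Definitions using (Asymmetric)
  open import Relation.Binary.PropositionalEquality
  open import Relation.Nullary using (contradiction)
  open Paths

  private
    variable
      n : ℕ

  ⟨$⟩ʳ-injective : (σ : Permutation′ n) → Injective _≡_ _≡_ (σ ⟨$⟩ʳ_)
  ⟨$⟩ʳ-injective σ e =
    trans (sym (inverseˡ σ)) (trans (cong (σ ⟨$⟩ˡ_) e) (inverseˡ σ))

  letters : List (List⁺ (Fin n)) → Word n
  letters = concatMap List⁺.toList

  ∈-letters⁺ : ∀ {bs : List (List⁺ (Fin n))} {b y} → b ∈ bs → y ∈ List⁺.toList b →
               y ∈ letters bs
  ∈-letters⁺ b∈ y∈ = ∈-concatMap⁺ List⁺.toList (lose b∈ y∈)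

  ∈-letters⁻ : ∀ (bs : List (List⁺ (Fin n))) {y} → y ∈ letters bs →
               ∃ λ b → b ∈ bs × y ∈ List⁺.toList b
  ∈-letters⁻ bs = find ∘ ∈-concatMap⁻ List⁺.toList

  BelowHead : List⁺ (Fin n) → Set
  BelowHead (x ∷ c) = All (_< x) c

  _<ʰ_ : List⁺ (Fin n) → List⁺ (Fin n) → Set
  _<ʰ_ = _<_ on List⁺.head

  CyclicPath : Permutation′ n → List⁺ (Fin n) → Set
  CyclicPath σ (x ∷ c) = Path (σ ⟨$⟩ʳ_) x c x

  -- Characterises the value of `cycles` without its computation, so that a rearranged list of
  -- blocks can be recognised as the cycles of a permutation. Strictness in `BelowHead` keeps the
  -- head out of its tail, which makes the tail a first-return word.
  record IsCycles (σ : Permutation′ n) (bs : List (List⁺ (Fin n))) : Set where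
    field
      below      : All BelowHead bs
      increasing : AllPairs _<ʰ_ bs
      paths      : All (CyclicPath σ) bs
      unique     : Unique (letters bs)
      complete   : ∀ i → i ∈ letters bs

  open IsCycles

  ≤-head : ∀ {x} {c : Word n} → All (_< x) c → ∀ {y} → y ∈ x ∷ c → y ≤ x
  ≤-head c<x (here refl) = ≤-refl
  ≤-head c<x (there y∈)  = <⇒≤ (All.lookup c<x y∈)

  head∉ : ∀ {x} {c : Word n} → All (_< x) c → x ∉ c
  head∉ c<x x∈ = <-irrefl refl (All.lookup c<x x∈)

  isCycles-resp-≈ : ∀ {σ σ′ : Permutation′ n} {bs} → σ ≈ σ′ → IsCycles σ bs → IsCycles σ′ bs
  isCycles-resp-≈ σ≈σ′ cs = record
    { below      = cs .below
    ; increasing = cs .increasing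
    ; paths      = All.map (λ { {_ ∷ c} → path-cong c (λ {y} _ → σ≈σ′ y) }) (cs .paths)
    ; unique     = cs .unique
    ; complete   = cs .complete
    }

  isCycles⇒≈ : ∀ {σ σ′ : Permutation′ n} {bs} → IsCycles σ bs → IsCycles σ′ bs → σ ≈ σ′
  isCycles⇒≈ {bs = bs} cs cs′ i with (_ ∷ c) , b∈ , i∈ ← ∈-letters⁻ bs (cs .complete i) =
    path-agree c (All.lookup (cs .paths) b∈) (All.lookup (cs′ .paths) b∈) i∈

  -- The first entries agree: otherwise each would lie in the tail of the other list, and the two
  -- would precede each other.
  sorted-unique : ∀ {A : Set} {R : A → A → Set} → Asymmetric R → {xs ys : List A} →
                  AllPairs R xs → AllPairs R ys →
                  (∀ {z} → z ∈ xs → z ∈ ys) → (∀ {z} → z ∈ ys → z ∈ xs) → xs ≡ ys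
  sorted-unique asym {[]}     {[]}     _ _ _ _ = refl
  sorted-unique asym {[]}     {_ ∷ _}  _ _ _ ⊇ = contradiction (⊇ (here refl)) λ ()
  sorted-unique asym {_ ∷ _}  {[]}     _ _ ⊆ _ = contradiction (⊆ (here refl)) λ ()
  sorted-unique {A} {R} asym {x ∷ xs} {y ∷ ys} (rx ∷ rxs) (ry ∷ rys) ⊆ ⊇
    with same (⊆ (here refl)) (⊇ (here refl))
    where
    same : x ∈ y ∷ ys → y ∈ x ∷ xs → x ≡ y
    same (here e)   _          = e
    same (there _)  (here e)   = sym e
    same (there x∈) (there y∈) = contradiction (All.lookup rx y∈) (asym (All.lookup ry x∈))
  ... | refl = cong (x ∷_) (sorted-unique asym rxs rys (shrink rx ⊆) (shrink ry ⊇))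
    where
    shrink : ∀ {us vs} → All (R x) us → (∀ {z} → z ∈ x ∷ us → z ∈ x ∷ vs) →
             ∀ {z} → z ∈ us → z ∈ vs
    shrink ru inc z∈ with inc (there z∈)
    ... | here refl = contradiction (All.lookup ru z∈) (λ r → asym r r)
    ... | there z∈′ = z∈′

  -- The head of a block is the largest letter of its orbit, which
  -- determines the blocks of a permutation.
  isCycles-unique : ∀ {σ : Permutation′ n} {bs bs′} → IsCycles σ bs → IsCycles σ bs′ → bs ≡ bs′
  isCycles-unique {n} {σ} cs cs′ =
    sorted-unique <-asym (cs .increasing) (cs′ .increasing) (included cs cs′) (included cs′ cs)
    where
    included : ∀ {bs bs′} → IsCycles σ bs → IsCycles σ bs′ → ∀ {b} → b ∈ bs → b ∈ bs′
    included {bs} {bs′} cs cs′ {x ∷ c} b∈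
      with (x′ ∷ c′) , b′∈ , x∈ ← ∈-letters⁻ bs′ (cs′ .complete x)
      with c<x   ← All.lookup (cs .below) b∈
         | p     ← All.lookup (cs .paths) b∈
         | c′<x′ ← All.lookup (cs′ .below) b′∈
         | p′    ← All.lookup (cs′ .paths) b′∈
      with refl ← ≤-antisym (≤-head c′<x′ x∈)
                            (≤-head c<x (cycle-closed c p (here refl) (path-to c′ p′ x∈)))
      = subst (λ c → (x ∷ c) ∈ bs′) (path-deterministic c′ c p′ p (head∉ c′<x′) (head∉ c<x)) b′∈

  cyclicPath-cycleFrom : (σ : Permutation′ n) (x : Fin n) → CyclicPath σ (cycleFrom σ x)
  cyclicPath-cycleFrom {n} σ x = path-takeWhile _≟_ n (∈-iterate (⟨$⟩ʳ-injective σ) x)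

  maximum : (x : Fin n) (c : Word n) → ∃ λ m → m ∈ x ∷ c × All (_≤ m) (x ∷ c)
  maximum x []      = x , here refl , ≤-refl ∷ []
  maximum x (y ∷ c) with m , m∈ , ≤m ← maximum y c with ≤-total x m
  ... | inj₁ x≤m = m , there m∈ , x≤m ∷ ≤m
  ... | inj₂ m≤x = x , here refl , ≤-refl ∷ All.map (λ y≤m → ≤-trans y≤m m≤x) ≤m

  isCycles-cycles : (σ : Permutation′ n) → IsCycles σ (cycles σ)
  isCycles-cycles {n} σ = record
    { below      = below′
    ; increasing = increasing′
    ; paths      = paths′
    ; unique     = Unique.concat⁺ (All.map⁺ (All.zipWith (uncurry distinct) (below′ , paths′)))
                     (AllPairs.map⁺ (pairs below′ paths′ increasing′))
    ; complete   = complete′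
    }
    where
    bs = cycles σ
    froms = map (cycleFrom σ) (allFin n)

    tailWithoutHead : ∀ x → x ∉ List⁺.tail (cycleFrom σ x)
    tailWithoutHead x x∈ =
      All.lookup (All.all-takeWhile _ (iterate (σ ⟨$⟩ʳ_) (σ ⟨$⟩ʳ x) n)) x∈ refl

    -- The filter gives only ≤; the inequality is strict because `takeWhile` stops before the head
    -- recurs.
    below′ : All BelowHead bs
    below′ = All.zipWith (λ { {_ ∷ _} (≤x , x∉) → All.tabulate λ y∈ →
                                ≤∧≢⇒< (All.lookup ≤x y∈) λ { refl → x∉ y∈ } })
      ( All.all-filter startsWithLargest? froms
      , All.filter⁺ startsWithLargest? 
          (All.map⁺ {P = λ b → List⁺.head b ∉ List⁺.tail b}
            (All.universal tailWithoutHead (allFin n))) )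

    paths′ : All (CyclicPath σ) bs
    paths′ = All.filter⁺ startsWithLargest?
               (All.map⁺ (All.universal (cyclicPath-cycleFrom σ) (allFin n)))

    increasing′ : AllPairs _<ʰ_ bs
    increasing′ = AllPairs.filter⁺ startsWithLargest?
                    (AllPairs.map⁺ (AllPairs.tabulate⁺-< λ i<j → i<j))

    distinct : ∀ {b} → BelowHead b → CyclicPath σ b → Unique (List⁺.toList b)
    distinct {x ∷ c} c<x p =
      All.¬Any⇒All¬ c (head∉ c<x) ∷ path-unique c p (head∉ c<x)

    -- From a common letter the second cycle leads to its head, which therefore lies in the first
    -- cycle and cannot exceed the first head.
    disjoint : ∀ {b b′} → BelowHead b → CyclicPath σ b → CyclicPath σ b′ → b <ʰ b′ →
               Disjoint (List⁺.toList b) (List⁺.toList b′)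
    disjoint {x ∷ c} {x′ ∷ c′} c<x p p′ x<x′ (z∈ , z∈′) =
      <-irrefl refl (<-≤-trans x<x′ (≤-head c<x (cycle-closed c p z∈ (path-to c′ p′ z∈′))))

    pairs : ∀ {bs} → All BelowHead bs → All (CyclicPath σ) bs → AllPairs _<ʰ_ bs →
            AllPairs (Disjoint on List⁺.toList) bs
    pairs []       []       []       = []
    pairs (b ∷ bs) (p ∷ ps) (r ∷ rs) =
      All.zipWith (uncurry (disjoint b p)) (ps , r) ∷ pairs bs ps rs

    -- The cycle of `i` is listed under its largest letter `m`: whatever `m` reaches lies on the
    -- cycle from `i`, so `cycleFrom σ m` passes the filter, and `m` in turn reaches `i`.
    complete′ : ∀ i → i ∈ letters bs
    complete′ i =
      let m , m∈ , ≤m = maximum i (List⁺.tail (cycleFrom σ i))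
          p           = cyclicPath-cycleFrom σ i
          q           = cyclicPath-cycleFrom σ m
      in
      ∈-letters⁺
        (∈-filter⁺ startsWithLargest? (∈-map⁺ (cycleFrom σ) (∈-allFin m))
          (All.tabulate λ y∈ →
            All.lookup ≤m (cycle-closed _ p m∈ (path-from _ q (there y∈)))))
        (cycle-closed _ q (here refl) (path-to _ p m∈))

-- Products of cycles and the inverse of `ι`.

module CycleProducts where

  open import Defs hiding (Unique; _∈_)
  open import Data.Fin.Base using (Fin; _<_)
  open import Data.Fin.Permutation
    using (Permutation′; _⟨$⟩ʳ_; _≈_; id; _∘ₚ_; transpose)
  open import Data.Fin.Properties using (_≟_; _<?_; <-asym)
  open import Data.List.Base using (List; []; _∷_; _++_; _∷ʳ_; foldr)
  open import Data.List.NonEmpty.Base using (List⁺; _∷_)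
  open import Data.List.Membership.Propositional using (_∈_; _∉_)
  open import Data.List.Membership.Propositional.Properties
    using (∈-++⁺ˡ; ∈-++⁺ʳ)
  open import Data.List.Properties using (++-assoc; ++-identityʳ)
  open import Data.List.Relation.Binary.Disjoint.Propositional
    using (Disjoint)
  open import Data.List.Relation.Unary.All as All using (All; []; _∷_)
  import Data.List.Relation.Unary.All.Properties as All
  open import Data.List.Relation.Unary.AllPairs using (AllPairs; []; _∷_)
  open import Data.List.Relation.Unary.Any using (here; there)
  open import Data.List.Relation.Unary.Unique.Propositional using (Unique)
  open import Data.Nat.Base using (ℕ)
  open import Data.Product.Base using (_×_; _,_; proj₁; proj₂)
  open import Function.Base using (_∘_)
  open import Relation.Binary.PropositionalEquality
  open import Relation.Nullary.Decidable using (dec-true; dec-false)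
  open Paths
  open Cycles

  private
    variable
      n : ℕ

  -- `c` is the part of the current tail already read and `c′` the part ahead. Letters of `c′` stay
  -- below `x`, while the next head exceeds `x`, so the cut falls exactly there.
  blocks-letters : ∀ (x : Fin n) c c′ bs → All (_< x) c′ → All BelowHead ((x ∷ c) ∷ bs) →
                   AllPairs _<ʰ_ ((x ∷ c) ∷ bs) →
                   blocks x c (c′ ++ letters bs) ≡ (x ∷ c ++ c′) ∷ bs
  blocks-letters x c (y ∷ c′) bs (y<x ∷ c′<x) (c<x ∷ below) (x< ∷ increasing)
    rewrite dec-true (y <? x) y<x
    = trans (blocks-letters x (c ∷ʳ y) c′ bs c′<x
               (All.++⁺ c<x (y<x ∷ []) ∷ below) (x< ∷ increasing))
            (cong (λ c → (x ∷ c) ∷ bs) (++-assoc c (y ∷ []) c′))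
  blocks-letters x c [] [] _ _ _ = cong (λ c → (x ∷ c) ∷ []) (sym (++-identityʳ c))
  blocks-letters x c [] ((y ∷ d) ∷ bs) _ (_ ∷ d<y ∷ below) ((x<y ∷ x<) ∷ increasing)
    rewrite dec-false (y <? x) (<-asym x<y)
    = cong₂ _∷_ (cong (x ∷_) (sym (++-identityʳ c)))
        (blocks-letters y [] d bs d<y ([] ∷ below) (rehead increasing))
    where
    rehead : AllPairs _<ʰ_ ((y ∷ d) ∷ bs) → AllPairs _<ʰ_ ((y ∷ []) ∷ bs)
    rehead (y< ∷ increasing) = y< ∷ increasing

  cycleProduct : List (List⁺ (Fin n)) → Permutation′ n
  cycleProduct = foldr (λ b π → cycle b ∘ₚ π) id

  ι⁻¹-letters : ∀ {bs : List (List⁺ (Fin n))} → All BelowHead bs → AllPairs _<ʰ_ bs →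
                ι⁻¹ (letters bs) ≡ cycleProduct bs
  ι⁻¹-letters {bs = []} _ _ = refl
  ι⁻¹-letters {bs = (x ∷ c) ∷ bs} (c<x ∷ below) (x< ∷ increasing) =
    cong cycleProduct (blocks-letters x [] c bs c<x ([] ∷ below) (x< ∷ increasing))

  transpose-≡ˡ : ∀ (i j : Fin n) → transpose i j ⟨$⟩ʳ i ≡ j
  transpose-≡ˡ i j rewrite dec-true (i ≟ i) refl = refl

  transpose-≡ʳ : ∀ {i j : Fin n} → j ≢ i → transpose i j ⟨$⟩ʳ j ≡ i
  transpose-≡ʳ {i = i} {j} j≢i rewrite dec-false (j ≟ i) j≢i | dec-true (j ≟ j) refl = refl

  transpose-≢ : ∀ {i j k : Fin n} → k ≢ i → k ≢ j → transpose i j ⟨$⟩ʳ k ≡ k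
  transpose-≢ {i = i} {j} {k} k≢i k≢j
    rewrite dec-false (k ≟ i) k≢i | dec-false (k ≟ j) k≢j = refl

  cycle-fixes : ∀ (x : Fin n) c {i} → i ∉ x ∷ c → cycle (x ∷ c) ⟨$⟩ʳ i ≡ i
  cycle-fixes x []      i∉ = refl
  cycle-fixes x (y ∷ c) i∉ =
    trans (cong (cycle (x ∷ c) ⟨$⟩ʳ_) (transpose-≢ (i∉ ∘ here) (i∉ ∘ there ∘ here)))
          (cycle-fixes x c λ { (here e) → i∉ (here e) ; (there i∈) → i∉ (there (there i∈)) })

  -- Applying `transpose x y` before `rest` inserts `y` directly after `x`: `x` goes to `y`, which
  -- `rest` fixes, and `y` goes where `rest` sends `x`.
  cyclicPath-cycle : ∀ (x : Fin n) c → Unique (x ∷ c) → CyclicPath (cycle (x ∷ c)) (x ∷ c)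
  cyclicPath-cycle x []      _ = refl
  cyclicPath-cycle x (y ∷ c) ((x≢y ∷ x≢c) ∷ (y≢c ∷ uc)) = first , second c refl
    where
    rest = cycle (x ∷ c)
    whole = cycle (x ∷ y ∷ c)

    p : CyclicPath rest (x ∷ c)
    p = cyclicPath-cycle x c (x≢c ∷ uc)

    first : whole ⟨$⟩ʳ x ≡ y
    first = trans (cong (rest ⟨$⟩ʳ_) (transpose-≡ˡ x y))
              (cycle-fixes x c λ { (here e) → x≢y (sym e) ; (there y∈) → All.lookup y≢c y∈ refl })

    y↦ : whole ⟨$⟩ʳ y ≡ rest ⟨$⟩ʳ x
    y↦ = cong (rest ⟨$⟩ʳ_) (transpose-≡ʳ (x≢y ∘ sym))

    other : ∀ {z} → z ∈ c → rest ⟨$⟩ʳ z ≡ whole ⟨$⟩ʳ z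
    other z∈ = sym (cong (rest ⟨$⟩ʳ_) (transpose-≢ (λ { refl → All.lookup x≢c z∈ refl })
                                                   (λ { refl → All.lookup y≢c z∈ refl })))

    second : ∀ c′ → c ≡ c′ → Path (whole ⟨$⟩ʳ_) y c′ x
    second []       refl = trans y↦ p
    second (z ∷ c′) refl = trans y↦ (proj₁ p) , path-cong c′ other (proj₂ p)

  unique-++⁻ : ∀ {A : Set} (xs : List A) {ys} → Unique (xs ++ ys) →
               Unique xs × Unique ys × Disjoint xs ys
  unique-++⁻ []       u        = [] , u , λ ()
  unique-++⁻ (x ∷ xs) (x≢ ∷ u) with uxs , uys , xs#ys ← unique-++⁻ xs u =
    All.++⁻ˡ xs x≢ ∷ uxs , uys , λ where
      (here refl , z∈ys) → All.lookup (All.++⁻ʳ xs x≢) z∈ys refl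
      (there z∈xs , z∈ys) → xs#ys (z∈xs , z∈ys)

  cycleProduct-fixes : ∀ (bs : List (List⁺ (Fin n))) {i} → i ∉ letters bs → cycleProduct bs ⟨$⟩ʳ i ≡ i
  cycleProduct-fixes []             i∉ = refl
  cycleProduct-fixes ((x ∷ c) ∷ bs) i∉ =
    trans (cong (cycleProduct bs ⟨$⟩ʳ_) (cycle-fixes x c (i∉ ∘ ∈-++⁺ˡ)))
          (cycleProduct-fixes bs (i∉ ∘ ∈-++⁺ʳ (x ∷ c)))

  -- The blocks are disjoint, so the first cycle fixes the letters of the other blocks and their
  -- product fixes the letters of the first.
  cycleProduct-paths : ∀ (bs : List (List⁺ (Fin n))) → Unique (letters bs) →
                       All (CyclicPath (cycleProduct bs)) bs
  cycleProduct-paths []             _ = []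
  cycleProduct-paths ((x ∷ c) ∷ bs) u with ub , ubs , disj ← unique-++⁻ (x ∷ c) u =
    path-cong c in-block p ∷
    All.tabulate λ { {_ ∷ c′} b∈ →
      path-cong c′ (λ y∈ → sym (cong (cycleProduct bs ⟨$⟩ʳ_)
                     (cycle-fixes x c λ y∈′ → disj (y∈′ , ∈-letters⁺ b∈ y∈))))
        (All.lookup (cycleProduct-paths bs ubs) b∈) }
    where
    p = cyclicPath-cycle x c ub
    in-block : ∀ {y} → y ∈ x ∷ c → cycle (x ∷ c) ⟨$⟩ʳ y ≡ cycleProduct ((x ∷ c) ∷ bs) ⟨$⟩ʳ y
    in-block y∈ = sym (cycleProduct-fixes bs λ y∈bs →
      disj (cycle-closed c p y∈ (refl ◅ ε) , y∈bs))
      where open import Relation.Binary.Construct.Closure.ReflexiveTransitive using (ε; _◅_)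

  isCycles-ι⁻¹ : ∀ {bs : List (List⁺ (Fin n))} → All BelowHead bs → AllPairs _<ʰ_ bs →
                 Unique (letters bs) → (∀ i → i ∈ letters bs) →
                 IsCycles (ι⁻¹ (letters bs)) bs
  isCycles-ι⁻¹ {bs = bs} below increasing unique complete = record
    { below      = below
    ; increasing = increasing
    ; paths      = subst (λ π → All (CyclicPath π) bs) (sym (ι⁻¹-letters below increasing))
                     (cycleProduct-paths bs unique)
    ; unique     = unique
    ; complete   = complete
    }

  module _ (σ : Permutation′ n) where
    open IsCycles (isCycles-cycles σ)

    ι⁻¹-ι : ι⁻¹ (ι σ) ≈ σ
    ι⁻¹-ι = isCycles⇒≈ (isCycles-ι⁻¹ below increasing unique complete) (isCycles-cycles σ)

  cycles-cong : ∀ (σ σ′ : Permutation′ n) → σ ≈ σ′ → cycles σ ≡ cycles σ′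
  cycles-cong σ σ′ σ≈σ′ =
    isCycles-unique (isCycles-resp-≈ σ≈σ′ (isCycles-cycles σ)) (isCycles-cycles σ′)

-- The effect of `φ′` on a word, and of the resulting hop on a permutation.

module Hops where

  open import Defs hiding (Unique; _∈_)
  open import Data.Fin.Base using (Fin; _<_)
  open import Data.Fin.Permutation using (Permutation′; _⟨$⟩ʳ_)
  open import Data.Fin.Properties using (_≟_; _<?_; <-asym)
  open import Data.List.Base
    using (List; []; _∷_; _++_; _∷ʳ_; reverse; takeWhile; dropWhile; drop;
           head; last)
  open import Data.List.NonEmpty.Base using (List⁺; _∷_)
  open import Data.List.Membership.Propositional using (_∈_; _∉_)
  open import Data.List.Membership.Propositional.Properties using (∈-++⁻)
  open import Data.List.Properties
    using (++-assoc; ++-identityʳ; reverse-++; reverse-involutive)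
  open import Data.List.Relation.Binary.Permutation.Propositional
    using (↭-sym)
  open import Data.List.Relation.Binary.Permutation.Propositional.Properties
    using (↭-reverse; All-resp-↭)
  open import Data.List.Relation.Unary.All as All using (All; []; _∷_)
  import Data.List.Relation.Unary.All.Properties as All
  open import Data.List.Relation.Unary.AllPairs using ([]; _∷_)
  open import Data.List.Relation.Unary.Any as Any using (Any; here; there)
  open import Data.Maybe.Base using (just)
  import Data.Maybe.Relation.Unary.All as Maybe-All
  import Data.Maybe.Relation.Unary.Any as Maybe-Any
  open import Data.Nat.Base using (ℕ)
  open import Data.Product.Base using (_×_; _,_; proj₁; proj₂)
  open import Data.Sum.Base using (_⊎_; inj₁; inj₂)
  open import Function.Base using (_∘_)
  open import Relation.Binary.PropositionalEquality
  open import Relation.Nullary using (¬_; contradiction; ¬?)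
  open import Relation.Nullary.Decidable using (dec-true; dec-false)
  open import Relation.Unary using (Decidable; ∁)
  open Paths
  open Cycles
  open CycleProducts

  private
    variable
      n : ℕ

  module _ {A : Set} {P : A → Set} (P? : Decidable P) where

    takeWhile-++ : ∀ {xs ys} → All P xs → Maybe-All.All (∁ P) (head ys) →
                   takeWhile P? (xs ++ ys) ≡ xs
    takeWhile-++ {[]} {[]}     _ _ = refl
    takeWhile-++ {[]} {y ∷ ys} _ (Maybe-All.just ¬py) rewrite dec-false (P? y) ¬py = refl
    takeWhile-++ {x ∷ xs} (px ∷ pxs) stop rewrite dec-true (P? x) px =
      cong (x ∷_) (takeWhile-++ pxs stop)

    dropWhile-++ : ∀ {xs ys} → All P xs → Maybe-All.All (∁ P) (head ys) →
                   dropWhile P? (xs ++ ys) ≡ ys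
    dropWhile-++ {[]} {[]}     _ _ = refl
    dropWhile-++ {[]} {y ∷ ys} _ (Maybe-All.just ¬py) rewrite dec-false (P? y) ¬py = refl
    dropWhile-++ {x ∷ xs} (px ∷ pxs) stop rewrite dec-true (P? x) px =
      dropWhile-++ pxs stop

  initOf : {A : Set} → A → List A → List A
  initOf a []      = []
  initOf a (y ∷ l) = a ∷ initOf y l

  init-last : {A : Set} (a : A) (l : List A) → a ∷ l ≡ initOf a l ∷ʳ lastOf a l
  init-last a []      = refl
  init-last a (y ∷ l) = cong (a ∷_) (init-last y l)

  lastOf∈ : {A : Set} (a : A) (l : List A) → lastOf a l ∈ a ∷ l
  lastOf∈ a []      = here refl
  lastOf∈ a (y ∷ l) = there (lastOf∈ y l)

  last-++ : {A : Set} (xs : List A) (y : A) (ys : List A) → last (xs ++ y ∷ ys) ≡ just (lastOf y ys)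
  last-++ []           y []        = refl
  last-++ []           y (y′ ∷ ys) = last-++ [] y′ ys
  last-++ (x ∷ [])     y ys        = last-++ [] y ys
  last-++ (x ∷ x′ ∷ xs) y ys       = last-++ (x′ ∷ xs) y ys

  reverse-lastOf : {A : Set} (l : List A) (a : A) (u : List A) →
                   head (reverse (l ++ a ∷ u)) ≡ just (lastOf a u)
  reverse-lastOf l a u = cong head (begin
    reverse (l ++ a ∷ u)                          ≡⟨ cong (λ v → reverse (l ++ v)) (init-last a u) ⟩
    reverse (l ++ initOf a u ∷ʳ lastOf a u)       ≡⟨ reverse-++ l (initOf a u ∷ʳ lastOf a u) ⟩
    reverse (initOf a u ∷ʳ lastOf a u) ++ reverse l
      ≡⟨ cong (_++ reverse l) (reverse-++ (initOf a u) (lastOf a u ∷ [])) ⟩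
    lastOf a u ∷ (reverse (initOf a u) ++ reverse l) ∎)
    where open ≡-Reasoning

  module _ {x : Fin n} {l : Word n} (x∉l : x ∉ l) (r : Word n) where

    private
      l≢x : All (_≢ x) l
      l≢x = All.map (λ x≢y → x≢y ∘ sym) (All.¬Any⇒All¬ l x∉l)

    leftOf-++ : leftOf x (l ++ x ∷ r) ≡ l
    leftOf-++ = takeWhile-++ (λ y → ¬? (y ≟ x)) l≢x (Maybe-All.just λ x≢x → x≢x refl)

    rightOf-++ : rightOf x (l ++ x ∷ r) ≡ r
    rightOf-++ = cong (drop 1) (dropWhile-++ (λ y → ¬? (y ≟ x)) l≢x
                   (Maybe-All.just λ x≢x → x≢x refl))

    peak-++ : Maybe-All.All (_< x) (last l) → Maybe-Any.Any (_< x) (head r) → Peak x (l ++ x ∷ r)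
    peak-++ below-l below-r =
      subst (Maybe-All.All (_< x) ∘ last) (sym leftOf-++) below-l ,
      subst (Maybe-Any.Any (_< x) ∘ head) (sym rightOf-++) below-r

    peak-++⁻ : Peak x (l ++ x ∷ r) → Maybe-All.All (_< x) (last l) × Maybe-Any.Any (_< x) (head r)
    peak-++⁻ (below-l , below-r) =
      subst (Maybe-All.All (_< x) ∘ last) leftOf-++ below-l ,
      subst (Maybe-Any.Any (_< x) ∘ head) rightOf-++ below-r

  φ′-peak : ∀ (x : Fin n) ρ → Peak x ρ → φ′ x ρ ≡ ρ
  φ′-peak x ρ pk rewrite dec-true (peak? x ρ) pk = refl

  φ′-¬peak : ∀ (x : Fin n) ρ → ¬ Peak x ρ → φ′ x ρ ≡ φ x ρ
  φ′-¬peak x ρ ¬pk rewrite dec-false (peak? x ρ) ¬pk = refl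

  module _ {x : Fin n} (l : Word n) (m : Fin n) (u : Word n) {w₂ w₃ r : Word n}
           (x∉ : x ∉ (l ++ m ∷ u) ++ w₂) (x<last : x < lastOf m u)
           (w₂<x : All (_< x) w₂) (w₃<x : All (_< x) w₃)
           (x<r : Maybe-All.All (x <_) (head r)) where

    private
      reverse-w₂<x : All (_< x) (reverse w₂)
      reverse-w₂<x = All-resp-↭ (↭-sym (↭-reverse w₂)) w₂<x

      stopˡ : Maybe-All.All (∁ (_< x)) (head (reverse (l ++ m ∷ u)))
      stopˡ = subst (Maybe-All.All (∁ (_< x))) (sym (reverse-lastOf l m u))
                (Maybe-All.just (<-asym x<last))

      stopʳ : Maybe-All.All (∁ (_< x)) (head r)
      stopʳ = Maybe-All.map <-asym x<r

      above-head : ∀ {y} → Maybe-All.All (x <_) y → ¬ Maybe-Any.Any (_< x) y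
      above-head (Maybe-All.just x<y) (Maybe-Any.just y<x) = <-asym x<y y<x

      not-peak : w₂ ≡ [] ⊎ w₃ ≡ [] →
                 ¬ (Maybe-All.All (_< x) (last ((l ++ m ∷ u) ++ w₂)) ×
                    Maybe-Any.Any (_< x) (head (w₃ ++ r)))
      not-peak (inj₁ refl) (below , _)
        with Maybe-All.just last<x ← subst (Maybe-All.All (_< x))
               (trans (cong last (++-identityʳ (l ++ m ∷ u))) (last-++ l m u)) below
        = <-asym last<x x<last
      not-peak (inj₂ refl) (_ , above) = above-head x<r above

      left : leftOf x ((l ++ m ∷ u) ++ w₂ ++ x ∷ w₃ ++ r) ≡ (l ++ m ∷ u) ++ w₂
      left = trans (cong (leftOf x) (sym (++-assoc (l ++ m ∷ u) w₂ (x ∷ w₃ ++ r))))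
                   (leftOf-++ x∉ (w₃ ++ r))

      right : rightOf x ((l ++ m ∷ u) ++ w₂ ++ x ∷ w₃ ++ r) ≡ w₃ ++ r
      right = trans (cong (rightOf x) (sym (++-assoc (l ++ m ∷ u) w₂ (x ∷ w₃ ++ r))))
                    (rightOf-++ x∉ (w₃ ++ r))

      reverse-left : reverse (leftOf x ((l ++ m ∷ u) ++ w₂ ++ x ∷ w₃ ++ r)) ≡
                     reverse w₂ ++ reverse (l ++ m ∷ u)
      reverse-left = trans (cong reverse left) (reverse-++ (l ++ m ∷ u) w₂)

    -- The letter before `w₂` exceeds `x`, and so does the letter after `w₃` if there is one. Hence
    -- these are the maximal factors of smaller letters, which `φ` exchanges.
    φ-swap : φ x ((l ++ m ∷ u) ++ w₂ ++ x ∷ w₃ ++ r) ≡ (l ++ m ∷ u) ++ w₃ ++ x ∷ w₂ ++ r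
    φ-swap =
      cong₂ _++_
        (trans (cong reverse (trans (cong (dropWhile (_<? x)) reverse-left)
                                    (dropWhile-++ (_<? x) reverse-w₂<x stopˡ)))
               (reverse-involutive (l ++ m ∷ u)))
        (cong₂ _++_
          (trans (cong (takeWhile (_<? x)) right) (takeWhile-++ (_<? x) w₃<x stopʳ))
          (cong (x ∷_) (cong₂ _++_
            (trans (cong reverse (trans (cong (takeWhile (_<? x)) reverse-left)
                                        (takeWhile-++ (_<? x) reverse-w₂<x stopˡ)))
                   (reverse-involutive w₂))
            (trans (cong (dropWhile (_<? x)) right) (dropWhile-++ (_<? x) w₃<x stopʳ)))))

    -- An empty factor leaves `x` next to a larger letter, or at the end of the word, where the
    -- neighbour is ∞; so `x` is not a peak.
    φ′-swap : w₂ ≡ [] ⊎ w₃ ≡ [] →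
              φ′ x ((l ++ m ∷ u) ++ w₂ ++ x ∷ w₃ ++ r) ≡ (l ++ m ∷ u) ++ w₃ ++ x ∷ w₂ ++ r
    φ′-swap empty =
      trans (φ′-¬peak x ((l ++ m ∷ u) ++ w₂ ++ x ∷ w₃ ++ r)
                      (not-peak empty ∘ peak-++⁻ x∉ (w₃ ++ r) ∘
                       subst (Peak x) (sym (++-assoc (l ++ m ∷ u) w₂ (x ∷ w₃ ++ r)))))
            φ-swap

  -- The double ascent x of σ becomes the double descent x of σ′: the factor
  -- a b … e x d of the word turns into a x b … e d.
  record Hop (x : Fin n) (σ σ′ : Permutation′ n) : Set where
    field
      {a b e d} : Fin n
      x<a : x < a
      x<d : x < d
      b<x : b < x
      e<x : e < x
      σa  : σ ⟨$⟩ʳ a ≡ b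
      σe  : σ ⟨$⟩ʳ e ≡ x
      σx  : σ ⟨$⟩ʳ x ≡ d
      σ′a : σ′ ⟨$⟩ʳ a ≡ x
      σ′x : σ′ ⟨$⟩ʳ x ≡ b
      σ′e : σ′ ⟨$⟩ʳ e ≡ d
      agree : ∀ {y} → y ≢ a → y ≢ e → y ≢ x → σ ⟨$⟩ʳ y ≡ σ′ ⟨$⟩ʳ y

  module _ {x m : Fin n} (B₁ B₂ : List (List⁺ (Fin n))) (u : Word n)
           {b : Fin n} {w r : Word n} where

    private
      bs  = B₁ ++ (m ∷ u ++ (b ∷ w) ++ x ∷ r) ∷ B₂
      bs′ = B₁ ++ (m ∷ u ++ x ∷ (b ∷ w) ++ r) ∷ B₂

    -- The two cycles share all arcs except those leaving the last letter of `m ∷ u`, the last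
    -- letter of `b ∷ w`, and `x`. The letter after `x` is `firstOf r m`, since an empty `r` closes
    -- the cycle at `m`.
    isCycles⇒hop : ∀ {σ σ′} → IsCycles σ bs → IsCycles σ′ bs′ →
                   x < lastOf m u → All (_< x) (b ∷ w) → x < firstOf r m → Hop x σ σ′
    isCycles⇒hop {σ} {σ′} cs cs′ x<a w<x x<d = record
      { x<a = x<a
      ; x<d = x<d
      ; b<x = All.head w<x
      ; e<x = All.lookup w<x (lastOf∈ b w)
      ; σa  = path-last u mu
      ; σe  = path-last w bw
      ; σx  = path-first r xr
      ; σ′a = path-last u mu′
      ; σ′x = proj₁ (proj₂ halves′)
      ; σ′e = trans (path-last w bw′) refl
      ; agree = agree
      }
      where
      open IsCycles
      all  = All.++⁻ B₁ (cs .paths)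
      all′ = All.++⁻ B₁ (cs′ .paths)
      halves  = path-++⁻ u (All.head (proj₂ all))
      halves′ = path-++⁻ u (All.head (proj₂ all′))
      mu  = proj₁ halves
      mu′ = proj₁ halves′
      quarters = path-++⁻ w (proj₂ halves)
      bw = proj₁ quarters
      xr = proj₂ quarters

      -- Unlike `path-++⁻`, this allows an empty `r`, where the path through `w` already ends at
      -- `z`; the path through `r` is claimed only for nonempty `r`.
      split : ∀ {f : Fin n → Fin n} {a z} w r → Path f a (w ++ r) z →
              Path f a w (firstOf r z) × (∀ {d r′} → r ≡ d ∷ r′ → Path f d r′ z)
      split []      []      p       = p , λ ()
      split []      (_ ∷ _) (e , p) = e , λ { refl → p }
      split (_ ∷ w) r       (e , p) = let q , rest = split w r p in (e , q) , rest

      ends′ = split w r (proj₂ (proj₂ halves′))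
      bw′ = proj₁ ends′

      agree : ∀ {y} → y ≢ lastOf m u → y ≢ lastOf b w → y ≢ x → σ ⟨$⟩ʳ y ≡ σ′ ⟨$⟩ʳ y
      agree {y} y≢a y≢e y≢x with ∈-letters⁻ bs (cs .complete y)
      ... | β , β∈ , y∈ with ∈-++⁻ B₁ β∈
      agree {y} y≢a y≢e y≢x | (_ ∷ c) , _ , y∈ | inj₁ β∈ =
        path-agree c (All.lookup (proj₁ all) β∈) (All.lookup (proj₁ all′) β∈) y∈
      agree {y} y≢a y≢e y≢x | (_ ∷ c) , _ , y∈ | inj₂ (there β∈) =
        path-agree c (All.lookup (All.tail (proj₂ all)) β∈)
          (All.lookup (All.tail (proj₂ all′)) β∈) y∈
      agree {y} y≢a y≢e y≢x | _ , _ , y∈ | inj₂ (here refl) with ∈-++⁻ (m ∷ u) y∈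
      ... | inj₁ y∈mu = path-agree-init u mu mu′ y∈mu y≢a
      ... | inj₂ y∈rest with ∈-++⁻ (b ∷ w) y∈rest
      ...   | inj₁ y∈bw         = path-agree-init w bw bw′ y∈bw y≢e
      ...   | inj₂ (here y≡x)   = contradiction y≡x y≢x
      ...   | inj₂ (there y∈r) = in-r r refl y∈r
        where
        in-r : ∀ r′ → r ≡ r′ → y ∈ r′ → σ ⟨$⟩ʳ y ≡ σ′ ⟨$⟩ʳ y
        in-r (d ∷ r′) refl y∈r = path-agree r′ (proj₂ xr) (proj₂ ends′ refl) y∈r

-- `τᶜ x` on a derangement: involution, number of cycles, and the change at `x`.

module Toggling where

  open import Defs hiding (Unique; _∈_)
  open import Data.Fin.Base using (Fin; _<_)
  open import Data.Fin.Permutation using (Permutation′; _⟨$⟩ʳ_; _≈_)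
  open import Data.Fin.Properties using (<-asym; <-cmp; <-trans)
  open import Data.List.Base using (List; []; _∷_; _++_; head; last; length)
  open import Data.List.NonEmpty.Base as List⁺ using (List⁺; _∷_)
  open import Data.List.Membership.Propositional using (_∈_; _∉_)
  open import Data.List.Membership.Propositional.Properties using (∈-∃++)
  open import Data.List.Properties using (++-assoc; concatMap-++; length-++)
  open import Data.List.Relation.Binary.Permutation.Propositional
    using (_↭_; prep; ↭-sym; ↭⇒↭ₛ)
  open import Data.List.Relation.Binary.Permutation.Propositional.Properties
    using (shift; ++⁺ˡ; ++⁺ʳ; ∈-resp-↭; All-resp-↭)
  import Data.List.Relation.Binary.Permutation.Setoid.Properties as ↭ₛ
  open import Data.List.Relation.Unary.All as All using (All; []; _∷_)
  import Data.List.Relation.Unary.All.Properties as All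
  open import Data.List.Relation.Unary.AllPairs as AllPairs
    using (AllPairs; []; _∷_)
  open import Data.List.Relation.Unary.Any as Any using (Any; here; there)
  open import Data.List.Relation.Unary.Unique.Propositional using (Unique)
  import Data.Maybe.Relation.Unary.All as Maybe-All
  import Data.Maybe.Relation.Unary.Any as Maybe-Any
  open import Data.Nat.Base using (ℕ)
  open import Data.Product.Base using (∃; ∃₂; _×_; _,_; proj₁; proj₂)
  open import Data.Sum.Base using (_⊎_; inj₁; inj₂; swap)
  open import Function.Base using (_∘_)
  open import Relation.Binary.Definitions using (tri<; tri≈; tri>)
  open import Relation.Binary.PropositionalEquality
  open import Relation.Nullary using (contradiction)
  open Paths
  open Cycles
  open CycleProducts
  open Hops

  private
    variable
      n : ℕ

  open IsCycles

  letters-++ : ∀ (B₁ : List (List⁺ (Fin n))) {b B₂} →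
               letters (B₁ ++ b ∷ B₂) ≡ letters B₁ ++ List⁺.toList b ++ letters B₂
  letters-++ B₁ {b} {B₂} = concatMap-++ List⁺.toList B₁ (b ∷ B₂)

  increasing-retail : ∀ (B₁ : List (List⁺ (Fin n))) {m c c′ B₂} →
                      AllPairs _<ʰ_ (B₁ ++ (m ∷ c) ∷ B₂) → AllPairs _<ʰ_ (B₁ ++ (m ∷ c′) ∷ B₂)
  increasing-retail []       (m< ∷ inc) = m< ∷ inc
  increasing-retail (_ ∷ B₁) (b< ∷ inc) with b<B₁ , b<m ∷ b<B₂ ← All.++⁻ B₁ b< =
    All.++⁺ b<B₁ (b<m ∷ b<B₂) ∷ increasing-retail B₁ inc

  module _ (B₁ : List (List⁺ (Fin n))) {m : Fin n} {c c′ : Word n} {B₂ : List (List⁺ (Fin n))}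
           (c↭c′ : c ↭ c′) {σ : Permutation′ n} (cs : IsCycles σ (B₁ ++ (m ∷ c) ∷ B₂)) where

    -- Permuting one tail keeps all heads and the set of letters, which is all that is needed for
    -- the blocks to be the cycles of the permutation that `ι⁻¹` builds from them.
    isCycles-rearrange : IsCycles (ι⁻¹ (letters (B₁ ++ (m ∷ c′) ∷ B₂))) (B₁ ++ (m ∷ c′) ∷ B₂)
    isCycles-rearrange = isCycles-ι⁻¹
      (All.++⁺ (proj₁ belows) (All-resp-↭ c↭c′ (All.head (proj₂ belows)) ∷ All.tail (proj₂ belows)))
      (increasing-retail B₁ (cs .increasing))
      (↭ₛ.Unique-resp-↭ (setoid _) (↭⇒↭ₛ letters-↭) (cs .unique))
      (λ i → ∈-resp-↭ letters-↭ (cs .complete i))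
      where
      belows = All.++⁻ B₁ (cs .below)
      letters-↭ : letters (B₁ ++ (m ∷ c) ∷ B₂) ↭ letters (B₁ ++ (m ∷ c′) ∷ B₂)
      letters-↭ = subst₂ _↭_ (sym (letters-++ B₁)) (sym (letters-++ B₁))
                    (++⁺ˡ (letters B₁) (prep m (++⁺ʳ (letters B₂) c↭c′)))

  -- Compares the cycle with the word. If `r` is empty the cycle returns to `m` while the word goes
  -- on with the next head or ends; that head exceeds `m` and hence `x`.
  head-letters-above : ∀ {m : Fin n} {B : List (List⁺ (Fin n))} (r : Word n) {x : Fin n} →
                       All ((m ∷ []) <ʰ_) B → x < m → x < firstOf r m →
                       Maybe-All.All (x <_) (head (r ++ letters B))
  head-letters-above (d ∷ r) _ _ x<d = Maybe-All.just x<d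
  head-letters-above {B = []} [] _ _ _ = Maybe-All.nothing
  head-letters-above {B = (m′ ∷ _) ∷ _} [] (m<m′ ∷ _) x<m _ = Maybe-All.just (<-trans x<m m<m′)

  increasing-after : ∀ (B₁ : List (List⁺ (Fin n))) {m c B₂} →
                     AllPairs _<ʰ_ (B₁ ++ (m ∷ c) ∷ B₂) → All ((m ∷ []) <ʰ_) B₂
  increasing-after []       (m< ∷ _)  = m<
  increasing-after (_ ∷ B₁) (_ ∷ inc) = increasing-after B₁ inc

  increasing-before : ∀ (B₁ : List (List⁺ (Fin n))) {m c B₂} →
                      AllPairs _<ʰ_ (B₁ ++ (m ∷ c) ∷ B₂) → All (_<ʰ (m ∷ [])) B₁
  increasing-before []       _          = []
  increasing-before (_ ∷ B₁) (b< ∷ inc) =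
    All.head (All.++⁻ʳ B₁ b<) ∷ increasing-before B₁ inc

  letters-reassoc : ∀ (B₁ : List (List⁺ (Fin n))) m u w₂ {x} w₃ r B₂ →
    letters (B₁ ++ (m ∷ u ++ w₂ ++ x ∷ w₃ ++ r) ∷ B₂) ≡
    (letters B₁ ++ m ∷ u) ++ w₂ ++ x ∷ w₃ ++ (r ++ letters B₂)
  letters-reassoc B₁ m u w₂ {x} w₃ r B₂ = begin
    letters (B₁ ++ (m ∷ u ++ w₂ ++ x ∷ w₃ ++ r) ∷ B₂)
      ≡⟨ letters-++ B₁ ⟩
    letters B₁ ++ (m ∷ u ++ w₂ ++ x ∷ w₃ ++ r) ++ letters B₂
      ≡⟨ cong (letters B₁ ++_) (++-assoc (m ∷ u) _ _) ⟩
    letters B₁ ++ (m ∷ u) ++ (w₂ ++ x ∷ w₃ ++ r) ++ letters B₂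
      ≡⟨ cong (λ v → letters B₁ ++ (m ∷ u) ++ v) (++-assoc w₂ _ _) ⟩
    letters B₁ ++ (m ∷ u) ++ w₂ ++ x ∷ (w₃ ++ r) ++ letters B₂
      ≡⟨ cong (λ v → letters B₁ ++ (m ∷ u) ++ w₂ ++ x ∷ v) (++-assoc w₃ r _) ⟩
    letters B₁ ++ (m ∷ u) ++ w₂ ++ x ∷ w₃ ++ (r ++ letters B₂)
      ≡⟨ ++-assoc (letters B₁) (m ∷ u) _ ⟨
    (letters B₁ ++ m ∷ u) ++ w₂ ++ x ∷ w₃ ++ (r ++ letters B₂) ∎
    where open ≡-Reasoning

  ι-isCycles : ∀ {σ : Permutation′ n} {bs} → IsCycles σ bs → ι σ ≡ letters bs
  ι-isCycles cs = cong letters (isCycles-unique (isCycles-cycles _) cs)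

  cyc-isCycles : ∀ {σ : Permutation′ n} {bs} → IsCycles σ bs → cyc σ ≡ length bs
  cyc-isCycles cs = cong length (isCycles-unique (isCycles-cycles _) cs)

  unique⇒∉ : ∀ {A : Set} (l : List A) {x r} → Unique (l ++ x ∷ r) → x ∉ l
  unique⇒∉ l u x∈l with _ , _ , disj ← unique-++⁻ l u = disj (x∈l , here refl)

  -- `τᶜ x` reads its argument only through `cycles`, which pointwise equality already determines;
  -- hence the propositional equality.
  τᶜ-cong : ∀ (x : Fin n) σ σ′ → σ ≈ σ′ → τᶜ x σ ≡ τᶜ x σ′
  τᶜ-cong x σ σ′ σ≈σ′ = cong (λ cs → ι⁻¹ (φ′ x (letters cs))) (cycles-cong σ σ′ σ≈σ′)

  module Swap {x m : Fin n} (B₁ B₂ : List (List⁺ (Fin n))) (u : Word n)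
              (x<last : x < lastOf m u) where

    arrangement : (w₂ w₃ r : Word n) → List (List⁺ (Fin n))
    arrangement w₂ w₃ r = B₁ ++ (m ∷ u ++ w₂ ++ x ∷ w₃ ++ r) ∷ B₂

    φ′-letters : ∀ {w₂ w₃ r σ} → IsCycles σ (arrangement w₂ w₃ r) →
                 All (_< x) w₂ → All (_< x) w₃ → x < firstOf r m → w₂ ≡ [] ⊎ w₃ ≡ [] →
                 φ′ x (letters (arrangement w₂ w₃ r)) ≡ letters (arrangement w₃ w₂ r)
    φ′-letters {w₂} {w₃} {r} cs w₂<x w₃<x x<r empty = begin
      φ′ x (letters (arrangement w₂ w₃ r))
        ≡⟨ cong (φ′ x) (letters-reassoc B₁ m u w₂ w₃ r B₂) ⟩
      φ′ x ((letters B₁ ++ m ∷ u) ++ w₂ ++ x ∷ w₃ ++ (r ++ letters B₂))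
        ≡⟨ φ′-swap (letters B₁) m u x∉ x<last w₂<x w₃<x
             (head-letters-above r
               (increasing-after B₁ {c = u ++ w₂ ++ x ∷ w₃ ++ r} (cs .increasing)) x<m x<r) empty ⟩
      (letters B₁ ++ m ∷ u) ++ w₃ ++ x ∷ w₂ ++ (r ++ letters B₂)
        ≡⟨ letters-reassoc B₁ m u w₃ w₂ r B₂ ⟨
      letters (arrangement w₃ w₂ r) ∎
      where
      open ≡-Reasoning
      x∉ : x ∉ (letters B₁ ++ m ∷ u) ++ w₂
      x∉ = unique⇒∉ ((letters B₁ ++ m ∷ u) ++ w₂) (subst Unique
             (trans (letters-reassoc B₁ m u w₂ w₃ r B₂)
                    (sym (++-assoc (letters B₁ ++ m ∷ u) w₂ _)))
             (cs .unique))
      x<m : x < m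
      x<m with lastOf∈ m u
      ... | here e   = subst (x <_) e x<last
      ... | there l∈ = <-trans x<last
              (All.lookup (All.++⁻ˡ u (All.head (All.++⁻ʳ B₁ (cs .below)))) l∈)

    module _ {w₂ w₃ r : Word n} {σ : Permutation′ n} (cs : IsCycles σ (arrangement w₂ w₃ r))
             (w₂<x : All (_< x) w₂) (w₃<x : All (_< x) w₃) (x<r : x < firstOf r m)
             (empty : w₂ ≡ [] ⊎ w₃ ≡ []) where

      private
        rearrangement : w₂ ≡ [] ⊎ w₃ ≡ [] → u ++ w₂ ++ x ∷ w₃ ++ r ↭ u ++ w₃ ++ x ∷ w₂ ++ r
        rearrangement (inj₁ refl) = ++⁺ˡ u (↭-sym (shift x w₃ r))
        rearrangement (inj₂ refl) = ++⁺ˡ u (shift x w₂ r)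

        τ≡ : τᶜ x σ ≡ ι⁻¹ (letters (arrangement w₃ w₂ r))
        τ≡ = cong ι⁻¹ (trans (cong (φ′ x) (ι-isCycles cs)) (φ′-letters cs w₂<x w₃<x x<r empty))

      isCycles-τᶜ : IsCycles (τᶜ x σ) (arrangement w₃ w₂ r)
      isCycles-τᶜ = subst (λ π → IsCycles π (arrangement w₃ w₂ r)) (sym τ≡)
                      (isCycles-rearrange B₁ (rearrangement empty) cs)

      -- The rearranged blocks meet the same hypotheses with `w₂` and `w₃` exchanged, so the second
      -- exchange undoes the first.
      τᶜ-twice : τᶜ x (τᶜ x σ) ≈ σ
      τᶜ-twice i = begin
        τᶜ x (τᶜ x σ) ⟨$⟩ʳ i
          ≡⟨ cong (λ ρ → ι⁻¹ (φ′ x ρ) ⟨$⟩ʳ i) (ι-isCycles isCycles-τᶜ) ⟩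
        ι⁻¹ (φ′ x (letters (arrangement w₃ w₂ r))) ⟨$⟩ʳ i
          ≡⟨ cong (λ ρ → ι⁻¹ ρ ⟨$⟩ʳ i) (φ′-letters isCycles-τᶜ w₃<x w₂<x x<r (swap empty)) ⟩
        ι⁻¹ (letters (arrangement w₂ w₃ r)) ⟨$⟩ʳ i ≡⟨ cong (λ ρ → ι⁻¹ ρ ⟨$⟩ʳ i) (ι-isCycles cs) ⟨
        ι⁻¹ (ι σ) ⟨$⟩ʳ i                           ≡⟨ ι⁻¹-ι σ i ⟩
        σ ⟨$⟩ʳ i                                   ∎
        where open ≡-Reasoning

      cyc-τᶜ : cyc (τᶜ x σ) ≡ cyc σ
      cyc-τᶜ = begin
        cyc (τᶜ x σ)                      ≡⟨ cyc-isCycles isCycles-τᶜ ⟩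
        length (arrangement w₃ w₂ r)      ≡⟨ length-++ B₁ ⟩
        length B₁ Data.Nat.Base.+ length ((m ∷ []) ∷ B₂) ≡⟨ length-++ B₁ ⟨
        length (arrangement w₂ w₃ r)      ≡⟨ cyc-isCycles cs ⟨
        cyc σ                             ∎
        where open ≡-Reasoning

  -- `w` is the longest suffix of letters below `x`, the future `w₂`. The second alternative serves
  -- the recursion, where `m` is an arbitrary letter; the head of a block with `x` in its tail
  -- excludes it.
  splitBelowRight : ∀ {x : Fin n} m c → x ∉ m ∷ c →
    (∃₂ λ u w → c ≡ u ++ w × x < lastOf m u × All (_< x) w) ⊎ All (_< x) (m ∷ c)
  splitBelowRight {x = x} m c x∉ with <-cmp x m
  splitBelowRight m c       x∉ | tri≈ _ x≡m _ = contradiction (here x≡m) x∉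
  splitBelowRight m []      x∉ | tri< x<m _ _ = inj₁ ([] , [] , refl , x<m , [])
  splitBelowRight m []      x∉ | tri> _ _ m<x = inj₂ (m<x ∷ [])
  splitBelowRight m (y ∷ c) x∉ | cmp with splitBelowRight y c (x∉ ∘ there) | cmp
  ... | inj₁ (u , w , refl , x<l , w<x) | _ = inj₁ (y ∷ u , w , refl , x<l , w<x)
  ... | inj₂ yc<x | tri< x<m _ _ = inj₁ ([] , y ∷ c , refl , x<m , yc<x)
  ... | inj₂ yc<x | tri> _ _ m<x = inj₂ (m<x ∷ yc<x)
  ... | inj₂ yc<x | tri≈ _ x≡m _ = contradiction (here x≡m) x∉

  splitBelowLeft : ∀ {x : Fin n} m c → x < m → x ∉ c →
    ∃₂ λ w r → c ≡ w ++ r × All (_< x) w × x < firstOf r m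
  splitBelowLeft m [] x<m x∉ = [] , [] , refl , [] , x<m
  splitBelowLeft {x = x} m (y ∷ c) x<m x∉ with <-cmp y x
  ... | tri≈ _ y≡x _ = contradiction (here (sym y≡x)) x∉
  ... | tri> _ _ x<y = [] , y ∷ c , refl , [] , x<y
  ... | tri< y<x _ _ with w , r , refl , w<x , x<r ← splitBelowLeft m c x<m (x∉ ∘ there) =
    y ∷ w , r , refl , y<x ∷ w<x , x<r

  -- A cyclic peak or a cyclic valley. The predecessor appears as a witness `y` because cyclic paths
  -- supply it in this form.
  Extremal : Fin n → Permutation′ n → Set
  Extremal x σ = ∃ λ y → σ ⟨$⟩ʳ y ≡ x ×
    ((y < x × σ ⟨$⟩ʳ x < x) ⊎ (x < y × x < σ ⟨$⟩ʳ x))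

  data Change (x : Fin n) (σ σ′ : Permutation′ n) : Set where
    fixed : Extremal x σ → σ′ ≈ σ → Change x σ σ′
    hopʳ  : Hop x σ σ′ → Change x σ σ′
    hopˡ  : Hop x σ′ σ → Change x σ σ′

  record Toggles (x : Fin n) (σ : Permutation′ n) : Set where
    constructor toggles
    field
      involutive    : τᶜ x (τᶜ x σ) ≈ σ
      cyc-preserved : cyc (τᶜ x σ) ≡ cyc σ
      change        : Change x σ (τᶜ x σ)

  toggles-fixed : ∀ {x : Fin n} {σ} → Extremal x σ → φ′ x (ι σ) ≡ ι σ → Toggles x σ
  toggles-fixed {x = x} {σ} extremal e = toggles
    (λ i → trans (cong (_⟨$⟩ʳ i) (τᶜ-cong x (τᶜ x σ) σ τ≈)) (τ≈ i))
    (cong length (cycles-cong (τᶜ x σ) σ τ≈))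
    (fixed extremal τ≈)
    where
    τ≈ : τᶜ x σ ≈ σ
    τ≈ i = trans (cong (λ ρ → ι⁻¹ ρ ⟨$⟩ʳ i) e) (ι⁻¹-ι σ i)

  peak-letters : ∀ {x : Fin n} {σ bs} l r → IsCycles σ bs → letters bs ≡ l ++ x ∷ r →
                 Maybe-All.All (_< x) (last l) → Maybe-Any.Any (_< x) (head r) →
                 φ′ x (ι σ) ≡ ι σ
  peak-letters {x = x} {σ} l r cs e below-l below-r =
    φ′-peak x (ι σ) (subst (Peak x) (sym eq)
      (peak-++ (unique⇒∉ l (subst Unique e (cs .unique))) r below-l below-r))
    where eq = trans (ι-isCycles cs) e

  -- A head is a peak of the word: all letters of earlier blocks are smaller, and the next letter
  -- belongs to its own block. An empty tail would make `x` a fixed point.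
  toggles-head : ∀ {x : Fin n} B₁ B₂ c {σ} → Derangement σ →
                 IsCycles σ (B₁ ++ (x ∷ c) ∷ B₂) → Toggles x σ
  toggles-head {x = x} B₁ B₂ [] der cs =
    contradiction (All.head (All.++⁻ʳ B₁ (cs .paths))) (der x)
  toggles-head {x = x} B₁ B₂ (y ∷ c) {σ} der cs = toggles-fixed
    (lastOf y c , path-last c (proj₂ path) ,
     inj₁ (All.lookup c<x (lastOf∈ y c) , subst (_< x) (sym (proj₁ path)) (All.head c<x)))
    (peak-letters (letters B₁) _ cs (letters-++ B₁) (All-last (All.concat⁺ (All.map⁺ before)))
      (Maybe-Any.just (All.head c<x)))
    where
    c<x  = All.head (All.++⁻ʳ B₁ (cs .below))
    path = All.head (All.++⁻ʳ B₁ (cs .paths))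
    before : All (λ b → All (_< x) (List⁺.toList b)) B₁
    before = All.zipWith (λ { {m ∷ d} (d<m , m<x) → m<x ∷ All.map (λ y<m → <-trans y<m m<x) d<m })
               (All.++⁻ˡ B₁ (cs .below) , increasing-before B₁ {c = y ∷ c} (cs .increasing))
    All-last : ∀ {l : Word _} → All (_< x) l → Maybe-All.All (_< x) (last l)
    All-last []                  = Maybe-All.nothing
    All-last (p ∷ [])            = Maybe-All.just p
    All-last (_ ∷ ps@(_ ∷ _))    = All-last ps

  -- Both factors empty: `x` is a valley and the exchange changes nothing. Both nonempty: `x` is a
  -- peak and `φ′` leaves the word alone. Only `w₃` empty: `x` is a double ascent and hops left over
  -- `w₂`; only `w₂` empty: the reverse hop.
  toggles-tail : ∀ {x m : Fin n} B₁ B₂ u w₂ w₃ r {σ} → x < lastOf m u → All (_< x) w₂ →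
                 All (_< x) w₃ → x < firstOf r m →
                 IsCycles σ (B₁ ++ (m ∷ u ++ w₂ ++ x ∷ w₃ ++ r) ∷ B₂) → Toggles x σ
  toggles-tail B₁ B₂ u [] [] r x<l w₂<x w₃<x x<r cs =
    toggles-fixed
      (_ , path-last u (proj₁ halves) ,
       inj₂ (x<l , subst (_ <_) (sym (path-first r (proj₂ halves))) x<r))
      (trans (cong (φ′ _) (ι-isCycles cs))
        (trans (S.φ′-letters cs w₂<x w₃<x x<r (inj₁ refl)) (sym (ι-isCycles cs))))
    where
    module S = Swap B₁ B₂ u x<l
    halves = path-++⁻ u (All.head (All.++⁻ʳ B₁ (cs .paths)))
  toggles-tail B₁ B₂ u (b ∷ w) [] r x<l w₂<x w₃<x x<r cs = toggles
    (S.τᶜ-twice cs w₂<x w₃<x x<r (inj₂ refl))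
    (S.cyc-τᶜ cs w₂<x w₃<x x<r (inj₂ refl))
    (hopʳ (isCycles⇒hop B₁ B₂ u cs (S.isCycles-τᶜ cs w₂<x w₃<x x<r (inj₂ refl)) x<l w₂<x x<r))
    where module S = Swap B₁ B₂ u x<l
  toggles-tail B₁ B₂ u [] (b ∷ w) r x<l w₂<x w₃<x x<r cs = toggles
    (S.τᶜ-twice cs w₂<x w₃<x x<r (inj₁ refl))
    (S.cyc-τᶜ cs w₂<x w₃<x x<r (inj₁ refl))
    (hopˡ (isCycles⇒hop B₁ B₂ u (S.isCycles-τᶜ cs w₂<x w₃<x x<r (inj₁ refl)) cs x<l w₃<x x<r))
    where module S = Swap B₁ B₂ u x<l
  toggles-tail {x = x} {m} B₁ B₂ u w₂@(b ∷ w) w₃@(b′ ∷ w′) r x<l w₂<x w₃<x x<r cs = toggles-fixed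
    (lastOf b w , path-last w (proj₁ quarters) ,
     inj₁ (last<x , subst (_< x) (sym (proj₁ (proj₂ quarters))) (All.head w₃<x)))
    (peak-letters ((letters B₁ ++ m ∷ u) ++ w₂) (w₃ ++ r ++ letters B₂) cs
      (trans (letters-reassoc B₁ m u w₂ w₃ r B₂) (sym (++-assoc (letters B₁ ++ m ∷ u) w₂ _)))
      (subst (Maybe-All.All (_< x)) (sym (last-++ (letters B₁ ++ m ∷ u) b w))
        (Maybe-All.just last<x))
      (Maybe-Any.just (All.head w₃<x)))
    where
    last<x = All.lookup w₂<x (lastOf∈ b w)
    quarters = path-++⁻ w (proj₂ (path-++⁻ u (All.head (All.++⁻ʳ B₁ (cs .paths)))))

  derangement-toggles : ∀ (x : Fin n) σ → Derangement σ → Toggles x σ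
  derangement-toggles x σ der
    with isCycles-cycles σ | ∈-letters⁻ (cycles σ) (isCycles-cycles σ .complete x)
  ... | cs | b , b∈ , x∈ with cycles σ | ∈-∃++ b∈
  ... | _ | B₁ , B₂ , refl = locate b x∈ cs
    where
    locate : ∀ b → x ∈ List⁺.toList b → IsCycles σ (B₁ ++ b ∷ B₂) → Toggles x σ
    locate (m ∷ c) (here refl) cs = toggles-head B₁ B₂ c der cs
    locate (m ∷ c) (there x∈c) cs with c₁ , c₂ , refl ← ∈-∃++ x∈c = split
      (splitBelowRight m c₁ x∉mc₁) (splitBelowLeft m c₂ x<m x∉c₂)
      where
      x<m : x < m
      x<m = All.lookup (All.head (All.++⁻ʳ B₁ (cs .below))) x∈c
      block-unique : Unique (m ∷ c₁ ++ x ∷ c₂)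
      block-unique = proj₁ (unique-++⁻ (m ∷ c₁ ++ x ∷ c₂) (proj₁ (proj₂
        (unique-++⁻ (letters B₁) (subst Unique (letters-++ B₁) (cs .unique))))))
      x∉mc₁ : x ∉ m ∷ c₁
      x∉mc₁ = unique⇒∉ (m ∷ c₁) block-unique
      x∉c₂ : x ∉ c₂
      x∉c₂ x∈c₂ = All.lookup
        (AllPairs.head (proj₁ (proj₂ (unique-++⁻ (m ∷ c₁) block-unique)))) x∈c₂ refl
      split : (∃₂ λ u w → c₁ ≡ u ++ w × x < lastOf m u × All (_< x) w) ⊎ All (_< x) (m ∷ c₁) →
              (∃₂ λ w r → c₂ ≡ w ++ r × All (_< x) w × x < firstOf r m) → Toggles x σ
      split (inj₂ (m<x ∷ _)) _ = contradiction m<x (<-asym x<m)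
      split (inj₁ (u , w₂ , refl , x<l , w₂<x)) (w₃ , r , refl , w₃<x , x<r) =
        toggles-tail B₁ B₂ u w₂ w₃ r x<l w₂<x w₃<x x<r
          (subst (λ c → IsCycles σ (B₁ ++ (m ∷ c) ∷ B₂)) (++-assoc u w₂ _) cs)

-- Types of the letters, their change under a hop, and their numbers.

module LetterTypes where

  open import Defs hiding (Unique; _∈_)
  open import Data.Bool.Base
    using (Bool; true; false; if_then_else_; not; _∧_)
  open import Data.Bool.Properties using (∧-comm)
  open import Data.Fin.Base using (Fin; zero; suc; _<_)
  open import Data.Fin.Permutation
    using (Permutation′; _⟨$⟩ʳ_; _⟨$⟩ˡ_; _≈_; inverseˡ; inverseʳ; flip)
  open import Data.Fin.Properties using (_≟_; _<?_; <-asym; <-trans; <-cmp)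
  open import Data.List.Base
    using (List; []; _∷_; length; allFin; filter; tabulate)
  open import Data.Nat.Base using (ℕ; suc; _+_)
  open import Data.Nat.Properties
    using (+-0-commutativeMonoid; +-cancelˡ-≡; +-suc)
  open import Data.Product.Base using (_,_)
  open import Data.Sum.Base using (inj₁; inj₂)
  import Algebra.Properties.CommutativeMonoid.Sum as Sum
  open import Function.Base using (_∘_; id)
  open import Relation.Binary.Definitions using (tri<; tri≈; tri>)
  open import Relation.Binary.PropositionalEquality
  open import Relation.Nullary using (yes; no; contradiction; does)
  open import Relation.Nullary.Decidable using (dec-true; dec-false)
  open import Relation.Unary using (Decidable)
  open Paths
  open Cycles
  open CycleProducts
  open Hops
  open Toggling

  private
    variable
      n : ℕ

  -- y is a double ascent, peak, valley or double descent according as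
  -- (enters σ y, leaves σ y) is (true, true), (true, false), (false, true)
  -- or (false, false).
  enters leaves : Permutation′ n → Fin n → Bool
  enters σ y = does (σ ⟨$⟩ˡ y <? y)
  leaves σ y = does (y <? σ ⟨$⟩ʳ y)

  ⟨$⟩ˡ-unique : ∀ (σ : Permutation′ n) {z y} → σ ⟨$⟩ʳ z ≡ y → σ ⟨$⟩ˡ y ≡ z
  ⟨$⟩ˡ-unique σ e = trans (cong (σ ⟨$⟩ˡ_) (sym e)) (inverseˡ σ)

  enters-via : ∀ (σ : Permutation′ n) {z y} → σ ⟨$⟩ʳ z ≡ y → enters σ y ≡ does (z <? y)
  enters-via σ {y = y} e = cong (λ z → does (z <? y)) (⟨$⟩ˡ-unique σ e)

  leaves-via : ∀ (σ : Permutation′ n) {z y} → σ ⟨$⟩ʳ y ≡ z → leaves σ y ≡ does (y <? z)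
  leaves-via σ {y = y} e = cong (λ z → does (y <? z)) e

  <?-true : ∀ {y z : Fin n} → y < z → does (y <? z) ≡ true
  <?-true {y = y} {z} = dec-true (y <? z)

  <?-false : ∀ {y z : Fin n} → z < y → does (y <? z) ≡ false
  <?-false {y = y} {z} z<y = dec-false (y <? z) (<-asym z<y)

  enters-cong : ∀ (σ σ′ : Permutation′ n) → σ ≈ σ′ → ∀ y → enters σ y ≡ enters σ′ y
  enters-cong σ σ′ σ≈σ′ y =
    enters-via σ (trans (σ≈σ′ (σ′ ⟨$⟩ˡ y)) (inverseʳ σ′))

  leaves-cong : ∀ (σ σ′ : Permutation′ n) → σ ≈ σ′ → ∀ y → leaves σ y ≡ leaves σ′ y
  leaves-cong σ _ σ≈σ′ y = leaves-via σ (σ≈σ′ y)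

  module _ {x : Fin n} {σ σ′ : Permutation′ n} (hop : Hop x σ σ′) where
    open Hop hop

    -- Besides `x` only `a` and `e` get new images: `a` falls to `b` or to `x`, and `e` rises to `x`
    -- or to `d`.
    hop-leaves : ∀ {y} → y ≢ x → leaves σ y ≡ leaves σ′ y
    hop-leaves {y} y≢x with y ≟ a | y ≟ e
    ... | yes refl | _ = trans
      (trans (leaves-via σ σa) (<?-false (<-trans b<x x<a)))
      (sym (trans (leaves-via σ′ σ′a) (<?-false x<a)))
    ... | no _ | yes refl = trans
      (trans (leaves-via σ σe) (<?-true e<x))
      (sym (trans (leaves-via σ′ σ′e) (<?-true (<-trans e<x x<d))))
    ... | no y≢a | no y≢e = leaves-via σ (agree y≢a y≢e y≢x)

    -- Besides `x` only `b` and `d` get new predecessors: `b` is reached from `a` or `x`, both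
    -- larger, and `d` from `x` or `e`, both smaller.
    hop-enters : ∀ {y} → y ≢ x → enters σ y ≡ enters σ′ y
    hop-enters {y} y≢x = compare (σ ⟨$⟩ˡ y) (inverseʳ σ)
      where
      compare : ∀ z → σ ⟨$⟩ʳ z ≡ y → enters σ y ≡ enters σ′ y
      compare z refl with z ≟ a | z ≟ e | z ≟ x
      ... | yes refl | _ | _ = trans
        (trans (enters-via σ refl) (<?-false (subst (_< a) (sym σa) (<-trans b<x x<a))))
        (sym (trans (enters-via σ′ (trans σ′x (sym σa))) (<?-false (subst (_< x) (sym σa) b<x))))
      ... | no _ | yes refl | _ = contradiction σe y≢x
      ... | no _ | no _ | yes refl = trans
        (trans (enters-via σ refl) (<?-true (subst (x <_) (sym σx) x<d)))
        (sym (trans (enters-via σ′ (trans σ′e (sym σx)))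
                    (<?-true (subst (e <_) (sym σx) (<-trans e<x x<d)))))
      ... | no z≢a | no z≢e | no z≢x =
        trans (enters-via σ refl) (sym (enters-via σ′ (sym (agree z≢a z≢e z≢x))))

    hop-ascent-enters : enters σ x ≡ true
    hop-ascent-enters = trans (enters-via σ σe) (<?-true e<x)

    hop-ascent-leaves : leaves σ x ≡ true
    hop-ascent-leaves = trans (leaves-via σ σx) (<?-true x<d)

    hop-descent-enters : enters σ′ x ≡ false
    hop-descent-enters = trans (enters-via σ′ σ′a) (<?-false x<a)

    hop-descent-leaves : leaves σ′ x ≡ false
    hop-descent-leaves = trans (leaves-via σ′ σ′x) (<?-false b<x)

  change-leaves : ∀ {x : Fin n} {σ σ′} → Change x σ σ′ → ∀ {y} → y ≢ x → leaves σ′ y ≡ leaves σ y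
  change-leaves {σ = σ} {σ′} (fixed _ σ′≈σ) {y} _ = leaves-cong σ′ σ σ′≈σ y
  change-leaves (hopʳ hop)     y≢x = sym (hop-leaves hop y≢x)
  change-leaves (hopˡ hop)     y≢x = hop-leaves hop y≢x

  change-enters : ∀ {x : Fin n} {σ σ′} → Change x σ σ′ → ∀ {y} → y ≢ x → enters σ′ y ≡ enters σ y
  change-enters {σ = σ} {σ′} (fixed _ σ′≈σ) {y} _ = enters-cong σ′ σ σ′≈σ y
  change-enters (hopʳ hop)     y≢x = sym (hop-enters hop y≢x)
  change-enters (hopˡ hop)     y≢x = hop-enters hop y≢x

  data Flipped : (p s p′ s′ : Bool) → Set where
    peak    : Flipped true false true false
    valley  : Flipped false true false true
    ascent  : Flipped true true false false
    descent : Flipped false false true true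

  flipped-resp : ∀ {p s p′ s′ P S P′ S′} → p ≡ P → s ≡ S → p′ ≡ P′ → s′ ≡ S′ →
                 Flipped P S P′ S′ → Flipped p s p′ s′
  flipped-resp refl refl refl refl flipped = flipped

  change-flipped : ∀ {x : Fin n} {σ σ′} → Change x σ σ′ →
                   Flipped (enters σ x) (leaves σ x) (enters σ′ x) (leaves σ′ x)
  change-flipped {x = x} {σ} {σ′} = λ where
    (fixed (y , σy≡x , inj₁ (y<x , σx<x)) σ′≈σ) →
      let p = trans (enters-via σ σy≡x) (<?-true y<x)
          s = <?-false σx<x
      in flipped-resp p s (trans (enters-cong σ′ σ σ′≈σ x) p) (trans (leaves-cong σ′ σ σ′≈σ x) s)
           peak
    (fixed (y , σy≡x , inj₂ (x<y , x<σx)) σ′≈σ) →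
      let p = trans (enters-via σ σy≡x) (<?-false x<y)
          s = <?-true x<σx
      in flipped-resp p s (trans (enters-cong σ′ σ σ′≈σ x) p) (trans (leaves-cong σ′ σ σ′≈σ x) s)
           valley
    (hopʳ hop) → flipped-resp (hop-ascent-enters hop) (hop-ascent-leaves hop)
                           (hop-descent-enters hop) (hop-descent-leaves hop) ascent
    (hopˡ hop) → flipped-resp (hop-descent-enters hop) (hop-descent-leaves hop)
                           (hop-ascent-enters hop) (hop-ascent-leaves hop) descent

  count : {A : Set} → (A → Bool) → List A → ℕ
  count f []      = 0
  count f (y ∷ l) = if f y then suc (count f l) else count f l

  count-cong : ∀ {A : Set} {f g : A → Bool} → f ≗ g → count f ≗ count g
  count-cong f≗g []      = refl
  count-cong {f = f} {g} f≗g (y ∷ l) rewrite f≗g y | count-cong f≗g l = refl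

  count-filter : ∀ {A : Set} {P : A → Set} (P? : Decidable P) l →
                 length (filter P? l) ≡ count (λ y → does (P? y)) l
  count-filter P? []      = refl
  count-filter P? (y ∷ l) with does (P? y)
  ... | true  = cong suc (count-filter P? l)
  ... | false = count-filter P? l

  count-split : ∀ {A : Set} (f g : A → Bool) l →
                count f l ≡ count (λ y → f y ∧ g y) l + count (λ y → f y ∧ not (g y)) l
  count-split f g [] = refl
  count-split f g (y ∷ l) with f y | g y
  ... | true  | true  = cong suc (count-split f g l)
  ... | true  | false = trans (cong suc (count-split f g l)) (sym (+-suc _ _))
  ... | false | _     = count-split f g l

  open Sum +-0-commutativeMonoid using (sum; sum-permute; sum-cong-≗)

  bit : Bool → ℕ
  bit b = if b then 1 else 0

  count-tabulate : ∀ {A : Set} (f : A → Bool) (g : Fin n → A) →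
                   count f (tabulate g) ≡ sum (bit ∘ f ∘ g)
  count-tabulate {ℕ.zero} f g = refl
  count-tabulate {suc n}  f g with f (g zero)
  ... | true  = cong suc (count-tabulate f (g ∘ suc))
  ... | false = count-tabulate f (g ∘ suc)

  enters-leaves-⟨$⟩ˡ : ∀ (σ : Permutation′ n) y → enters σ y ≡ leaves σ (σ ⟨$⟩ˡ y)
  enters-leaves-⟨$⟩ˡ σ y = cong (λ z → does (σ ⟨$⟩ˡ y <? z)) (sym (inverseʳ σ))

  -- A rising arc is counted by `leaves` at its source and by `enters` at its target, so reindexing
  -- along σ matches the two counts.
  count-enters : ∀ (σ : Permutation′ n) →
                 count (enters σ) (allFin n) ≡ count (leaves σ) (allFin n)
  count-enters {n} σ = begin
    count (enters σ) (allFin n)               ≡⟨ count-tabulate (enters σ) id ⟩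
    sum (bit ∘ enters σ)                      ≡⟨ sum-cong-≗ (cong bit ∘ enters-leaves-⟨$⟩ˡ σ) ⟩
    sum (bit ∘ leaves σ ∘ (σ ⟨$⟩ˡ_))          ≡⟨ sum-permute (bit ∘ leaves σ) (flip σ) ⟨
    sum (bit ∘ leaves σ)                      ≡⟨ count-tabulate (leaves σ) id ⟨
    count (leaves σ) (allFin n)               ∎
    where open ≡-Reasoning

  isPeak isValley : Permutation′ n → Fin n → Bool
  isPeak   σ y = enters σ y ∧ not (leaves σ y)
  isValley σ y = leaves σ y ∧ not (enters σ y)

  -- Removing the double ascents from both sides of `count-enters` leaves the peaks on one side and
  -- the valleys on the other.
  count-peaks : ∀ (σ : Permutation′ n) →
                 count (isPeak σ) (allFin n) ≡ count (isValley σ) (allFin n)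
  count-peaks {n} σ = +-cancelˡ-≡ both _ _ (begin
    both + count (isPeak σ) (allFin n)   ≡⟨ count-split (enters σ) (leaves σ) (allFin n) ⟨
    count (enters σ) (allFin n)          ≡⟨ count-enters σ ⟩
    count (leaves σ) (allFin n)          ≡⟨ count-split (leaves σ) (enters σ) (allFin n) ⟩
    count (λ y → leaves σ y ∧ enters σ y) (allFin n) + count (isValley σ) (allFin n)
      ≡⟨ cong (_+ count (isValley σ) (allFin n))
           (count-cong (λ y → ∧-comm (leaves σ y) (enters σ y)) (allFin n)) ⟩
    both + count (isValley σ) (allFin n) ∎)
    where
    open ≡-Reasoning
    both = count (λ y → enters σ y ∧ leaves σ y) (allFin n)

  exc-count : ∀ (σ : Permutation′ n) → exc σ ≡ count (leaves σ) (allFin n)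
  exc-count {n} σ = count-filter (λ i → i <? σ ⟨$⟩ʳ i) (allFin n)

  -- `cpk` asks that `y` be sent below itself, `isPeak` only that it not rise; without fixed points
  -- these agree.
  cpk-count : ∀ {σ : Permutation′ n} → Derangement σ → cpk σ ≡ count (isPeak σ) (allFin n)
  cpk-count {n} {σ} der = trans (count-filter _ (allFin n))
    (count-cong (λ y → cong (enters σ y ∧_) (falls y)) (allFin n))
    where
    falls : ∀ y → does (σ ⟨$⟩ʳ y <? y) ≡ not (leaves σ y)
    falls y with <-cmp (σ ⟨$⟩ʳ y) y
    ... | tri< σy<y _ _ rewrite <?-true σy<y | <?-false σy<y = refl
    ... | tri≈ _ e _ = contradiction e (der y)
    ... | tri> _ _ y<σy rewrite <?-true y<σy | <?-false y<σy = refl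

-- Sums over finite sets given as duplicate-free lists.

module FiniteSums where

  open import Algebra.Bundles using (CommutativeMonoid)
  open import Data.List.Base using (List; []; _∷_; map; foldr)
  import Data.List.Membership.Setoid
  import Data.List.Membership.Setoid.Properties as Membership
  open import Data.List.Properties using (map-∘)
  open import Data.List.Relation.Unary.All as All using (All; []; _∷_)
  import Data.List.Relation.Unary.All.Properties as All
  open import Data.List.Relation.Unary.AllPairs using ([]; _∷_)
  open import Data.List.Relation.Unary.Any using (here; there)
  import Data.List.Relation.Unary.Unique.Setoid
  open import Data.Product.Base using (_,_)
  open import Data.Sum.Base using (_⊎_; inj₁; inj₂)
  open import Function.Base using (_∘_)
  open import Level using (0ℓ)
  open import Relation.Binary.Bundles using (Setoid)
  open import Relation.Binary.PropositionalEquality using (cong)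
  open import Relation.Nullary using (¬_; contradiction)

  module FiniteSet (S : Setoid 0ℓ 0ℓ) where
    open Setoid S using (_≈_; trans; sym) renaming (Carrier to A)
    open Data.List.Membership.Setoid S using (_∈_)
    open Data.List.Relation.Unary.Unique.Setoid S using (Unique)

    remove : ∀ {z ys} → z ∈ ys → List A
    remove {ys = _ ∷ ys} (here _)  = ys
    remove {ys = y ∷ _}  (there i) = y ∷ remove i

    ∈-remove : ∀ {z w ys} (i : z ∈ ys) → w ∈ ys → w ≈ z ⊎ w ∈ remove i
    ∈-remove (here z≈y) (here w≈y)  = inj₁ (trans w≈y (sym z≈y))
    ∈-remove (here _)   (there w∈)  = inj₂ w∈
    ∈-remove (there i)  (here w≈y)  = inj₂ (here w≈y)
    ∈-remove (there i)  (there w∈) with ∈-remove i w∈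
    ... | inj₁ w≈z = inj₁ w≈z
    ... | inj₂ w∈′ = inj₂ (there w∈′)

    remove-⊆ : ∀ {z w ys} (i : z ∈ ys) → w ∈ remove i → w ∈ ys
    remove-⊆ (here _)  w∈          = there w∈
    remove-⊆ (there i) (here w≈y)  = here w≈y
    remove-⊆ (there i) (there w∈)  = there (remove-⊆ i w∈)

    fresh : ∀ {y z ys} → All (λ v → ¬ y ≈ v) ys → z ∈ ys → ¬ y ≈ z
    fresh y≉ z∈ y≈z with y≉v , z≈v ← All.lookupAny y≉ z∈ = y≉v (trans y≈z z≈v)

    remove-∌ : ∀ {z w ys} → Unique ys → (i : z ∈ ys) → w ∈ remove i → ¬ w ≈ z
    remove-∌ (y≉ ∷ _) (here z≈y) w∈         w≈z = fresh y≉ w∈ (sym (trans w≈z z≈y))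
    remove-∌ (y≉ ∷ _) (there i)  (here w≈y) w≈z = fresh y≉ i (trans (sym w≈y) w≈z)
    remove-∌ (_ ∷ u)  (there i)  (there w∈) w≈z = remove-∌ u i w∈ w≈z

    remove-unique : ∀ {z ys} → Unique ys → (i : z ∈ ys) → Unique (remove i)
    remove-unique (_ ∷ u)  (here _)  = u
    remove-unique (y≉ ∷ u) (there i) =
      All.tabulateₛ S (λ w∈ → fresh y≉ (remove-⊆ i w∈)) ∷ remove-unique u i

  module SetSum (S : Setoid 0ℓ 0ℓ) {c ℓ} (M : CommutativeMonoid c ℓ) where
    open Setoid S using () 
      renaming (Carrier to A; _≈_ to _≈ₛ_; sym to symₛ; trans to transₛ; refl to reflₛ)
    open Data.List.Membership.Setoid S using (_∈_)
    open Data.List.Relation.Unary.Unique.Setoid S using (Unique)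
    open FiniteSet S
    open CommutativeMonoid M
    open import Relation.Binary.Reasoning.Setoid setoid

    total : (A → Carrier) → List A → Carrier
    total F xs = foldr _∙_ ε (map F xs)

    module _ {F : A → Carrier} (F-cong : ∀ {x y} → x ≈ₛ y → F x ≈ F y) where

      total-remove : ∀ {z ys} (i : z ∈ ys) → total F ys ≈ F z ∙ total F (remove i)
      total-remove (here z≈y) = ∙-congʳ (F-cong (symₛ z≈y))
      total-remove {z} {y ∷ ys} (there i) = begin
        F y ∙ total F ys               ≈⟨ ∙-congˡ (total-remove i) ⟩
        F y ∙ (F z ∙ total F (remove i)) ≈⟨ assoc _ _ _ ⟨
        (F y ∙ F z) ∙ total F (remove i) ≈⟨ ∙-congʳ (comm _ _) ⟩
        (F z ∙ F y) ∙ total F (remove i) ≈⟨ assoc _ _ _ ⟩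
        F z ∙ (F y ∙ total F (remove i)) ∎

      -- Induction on `xs`: deleting the occurrence of its first entry from `ys` keeps `ys`
      -- duplicate-free and the members of the two lists the same.
      total-set : ∀ {xs ys} → Unique xs → Unique ys →
                  (∀ {z} → z ∈ xs → z ∈ ys) → (∀ {z} → z ∈ ys → z ∈ xs) →
                  total F xs ≈ total F ys
      total-set {[]} {[]}    _ _ _ _ = refl
      total-set {[]} {_ ∷ _} _ _ _ ⊇ = contradiction (⊇ (here reflₛ)) λ ()
      total-set {x ∷ xs} {ys} (x≉ ∷ uxs) uys ⊆ ⊇ = begin
        F x ∙ total F xs         ≈⟨ ∙-congˡ (total-set uxs (remove-unique uys x∈) to from) ⟩
        F x ∙ total F (remove x∈) ≈⟨ total-remove x∈ ⟨
        total F ys               ∎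
        where
        x∈ = ⊆ (here reflₛ)
        to : ∀ {z} → z ∈ xs → z ∈ remove x∈
        to z∈ with ∈-remove x∈ (⊆ (there z∈))
        ... | inj₁ z≈x = contradiction (symₛ z≈x) (fresh x≉ z∈)
        ... | inj₂ z∈′ = z∈′
        from : ∀ {z} → z ∈ remove x∈ → z ∈ xs
        from z∈ with ⊇ (remove-⊆ x∈ z∈)
        ... | here z≈x  = contradiction z≈x (remove-∌ uys x∈ z∈)
        ... | there z∈′ = z∈′

      -- `map τ xs` lists the same set: it is duplicate-free since `τ` undoes itself on `xs`, and
      -- each member `z` is the image of `τ z`.
      total-involution : ∀ {τ : A → A} {xs} → (∀ {x y} → x ≈ₛ y → τ x ≈ₛ τ y) →
                         Unique xs → (∀ {x} → x ∈ xs → τ x ∈ xs) →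
                         (∀ {x} → x ∈ xs → τ (τ x) ≈ₛ x) →
                         total (F ∘ τ) xs ≈ total F xs
      total-involution {τ} {xs} τ-cong uxs closed invol = begin
        total (F ∘ τ) xs   ≡⟨ cong (foldr _∙_ ε) (map-∘ xs) ⟩
        total F (map τ xs) ≈⟨ total-set (unique-map (All.tabulateₛ S invol) uxs) uxs to from ⟩
        total F xs         ∎
        where
        unique-map : ∀ {xs} → All (λ x → τ (τ x) ≈ₛ x) xs → Unique xs → Unique (map τ xs)
        unique-map []         []       = []
        unique-map (e ∷ es)   (x≉ ∷ u) =
          All.map⁺ (All.zipWith (λ (e′ , x≉y) τx≈τy →
            x≉y (transₛ (symₛ e) (transₛ (τ-cong τx≈τy) e′))) (es , x≉)) ∷ unique-map es u
        to : ∀ {z} → z ∈ map τ xs → z ∈ xs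
        to z∈ with y , y∈ , z≈τy ← Membership.∈-map⁻ S S z∈ =
          Membership.∈-resp-≈ S (symₛ z≈τy) (closed y∈)
        from : ∀ {z} → z ∈ xs → z ∈ map τ xs
        from z∈ = Membership.∈-resp-≈ S (invol z∈) (Membership.∈-map⁺ S S τ-cong (closed z∈))

-- Sums over an invariant set, weighted by letter types.

module WeightedSums where

  open import Defs hiding (_∈_; Unique)
  open import Algebra.Bundles using (CommutativeRing)
  open import Data.Bool.Base
    using (Bool; true; false; if_then_else_; not; _∧_)
  open import Data.Fin.Base using (Fin)
  open import Data.Fin.Permutation
    using (Permutation′; _⟨$⟩ʳ_) renaming (_≈_ to _≈ₚ_)
  open import Data.Fin.Subset using (⁅_⁆)
  open import Data.Fin.Subset.Properties using (_∈?_; x∈⁅x⁆; x∈⁅y⁆⇒x≡y)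
  open import Data.List.Base
    using (List; []; _∷_; length; allFin; filter; foldr)
  open import Data.List.Membership.Propositional using (_∈_)
  open import Data.List.Membership.Propositional.Properties
    using (∈-filter⁺; ∈-filter⁻; ∈-allFin)
  open import Data.List.Properties using (length-tabulate)
  open import Data.List.Relation.Unary.All as All using (All; []; _∷_)
  open import Data.List.Relation.Unary.AllPairs using ([]; _∷_)
  open import Data.List.Relation.Unary.Any as Any using (here; there)
  open import Data.List.Relation.Unary.Unique.Propositional using (Unique)
  import Data.List.Relation.Unary.Unique.Propositional.Properties as Unique
  open import Data.Nat.Base using (ℕ)
  open import Data.Product.Base using (_,_; proj₂)
  open import Data.Vec.Base using ([]; _∷_)
  open import Function.Base using (_∘_; id)
  open import Relation.Binary.PropositionalEquality as ≡ using (_≡_; _≢_)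
  open Cycles
  open CycleProducts
  open Toggling
  open LetterTypes
  open FiniteSums

  open Defs using () renaming (_∈_ to _∈ₚ_)

  private
    variable
      n : ℕ

  filter-singleton : ∀ (x : Fin n) → filter (_∈? ⁅ x ⁆) (allFin n) ≡ x ∷ []
  filter-singleton {n} x = sorted-unique {R = Data.Fin.Base._<_} <-asym
    (AllPairs.filter⁺ (_∈? ⁅ x ⁆) (AllPairs.tabulate⁺-< id)) ([] ∷ [])
    (λ z∈ → here (x∈⁅y⁆⇒x≡y x (proj₂ (∈-filter⁻ (_∈? ⁅ x ⁆) {xs = allFin n} z∈))))
    (λ { (here ≡.refl) → ∈-filter⁺ (_∈? ⁅ x ⁆) (∈-allFin x) (x∈⁅x⁆ x) })
    where
    import Data.List.Relation.Unary.AllPairs.Properties as AllPairs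
    open import Data.Fin.Properties using (<-asym)

  module _ {n : ℕ} where

    -- For a one-element subset the product `τᶜ[_]` has the single factor `τᶜ x`.
    τᶜ-closed : ∀ {Π : List (Permutation′ n)} → CMFS-Invariant Π →
                ∀ x {σ} → σ ∈ₚ Π → τᶜ x σ ∈ₚ Π
    τᶜ-closed {Π} inv x {σ} σ∈ =
      ≡.subst (λ xs → foldr τᶜ σ xs ∈ₚ Π) (filter-singleton x) (inv σ σ∈ ⁅ x ⁆)

    derangement-resp : ∀ (σ σ′ : Permutation′ n) → σ ≈ₚ σ′ → Derangement σ → Derangement σ′
    derangement-resp _ _ σ≈σ′ der i e = der i (≡.trans (σ≈σ′ i) e)

  module Weights {c ℓ} (R : CommutativeRing c ℓ) where
    open CommutativeRing R
    open Enumerators R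
    open import Relation.Binary.Reasoning.Setoid setoid
    open import Algebra.Solver.Ring.NaturalCoefficients.Default commutativeSemiring
      using (solve; _:=_; _:+_; _:*_; con)
    open import Algebra.Properties.Semiring.Exp semiring using (^-congˡ)
    open import Algebra.Properties.CommutativeSemiring.Exp commutativeSemiring using (^-distrib-*)

    letter : (q₁ q₂ d e : Carrier) → Bool → Bool → Carrier
    letter q₁ q₂ d e enters leaves =
      if enters then (if leaves then d else q₁) else (if leaves then q₂ else e)

    letterAt : (q₁ q₂ d e : Carrier) → Permutation′ n → Fin n → Carrier
    letterAt q₁ q₂ d e σ y = letter q₁ q₂ d e (enters σ y) (leaves σ y)

    ∏ : {A : Set} → (A → Carrier) → List A → Carrier
    ∏ f []      = 1#
    ∏ f (y ∷ l) = f y * ∏ f l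

    ∏-cong : ∀ {A : Set} {f g : A → Carrier} l → (∀ {y} → y ∈ l → f y ≈ g y) → ∏ f l ≈ ∏ g l
    ∏-cong []      f≈g = refl
    ∏-cong (y ∷ l) f≈g = *-cong (f≈g (here ≡.refl)) (∏-cong l (f≈g ∘ there))

    ∏-* : ∀ {A : Set} (f g : A → Carrier) l → ∏ (λ y → f y * g y) l ≈ ∏ f l * ∏ g l
    ∏-* f g []      = sym (*-identityˡ 1#)
    ∏-* f g (y ∷ l) = begin
      f y * g y * ∏ (λ y → f y * g y) l ≈⟨ *-congˡ (∏-* f g l) ⟩
      f y * g y * (∏ f l * ∏ g l)
        ≈⟨ solve 4 (λ a b c d → a :* b :* (c :* d) := a :* c :* (b :* d)) refl _ _ _ _ ⟩
      f y * ∏ f l * (g y * ∏ g l)       ∎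

    ∏-const : ∀ {A : Set} a (l : List A) → ∏ (λ _ → a) l ≈ a ^ length l
    ∏-const a []      = refl
    ∏-const a (_ ∷ l) = *-congˡ (∏-const a l)

    ∏-count : ∀ {A : Set} (f : A → Bool) a l → ∏ (λ y → if f y then a else 1#) l ≈ a ^ count f l
    ∏-count f a []      = refl
    ∏-count f a (y ∷ l) with f y
    ... | true  = *-congˡ (∏-count f a l)
    ... | false = trans (*-identityˡ _) (∏-count f a l)

    letterAt-cong : ∀ {q₁ q₂ d e} (σ σ′ : Permutation′ n) → σ ≈ₚ σ′ →
                    ∀ y → letterAt q₁ q₂ d e σ y ≡ letterAt q₁ q₂ d e σ′ y
    letterAt-cong {q₁ = q₁} {q₂} {d} {e} σ σ′ σ≈σ′ y =
      ≡.cong₂ (letter q₁ q₂ d e) (enters-cong σ σ′ σ≈σ′ y) (leaves-cong σ σ′ σ≈σ′ y)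

    letterAt-τᶜ : ∀ {q₁ q₂ d e} {x} (σ : Permutation′ n) → Derangement σ → ∀ {y} → y ≢ x →
                  letterAt q₁ q₂ d e (τᶜ x σ) y ≡ letterAt q₁ q₂ d e σ y
    letterAt-τᶜ {q₁ = q₁} {q₂} {d} {e} {x} σ der {y} y≢x =
      ≡.cong₂ (letter q₁ q₂ d e) (change-enters change y≢x) (change-leaves change y≢x)
      where open Toggles (derangement-toggles x σ der)

    module Chain {n : ℕ} (Π : List (Permutation′ n)) (Π-unique : Defs.Unique Π)
                 (Π-derangements : All Derangement Π) (Π-invariant : CMFS-Invariant Π) where
      open SetSum (permutationSetoid n) +-commutativeMonoid public

      derangement : ∀ {σ} → σ ∈ₚ Π → Derangement σ
      derangement {σ} σ∈ with der , σ≈ ← All.lookupAny Π-derangements σ∈ =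
        derangement-resp (Any.lookup σ∈) σ (λ i → ≡.sym (σ≈ i)) der

      total-cong : ∀ {F G} → (∀ σ → Derangement σ → F σ ≈ G σ) → total F Π ≈ total G Π
      total-cong F≈G = go Π-derangements
        where
        go : ∀ {Ω} → All Derangement Ω → total _ Ω ≈ total _ Ω
        go []           = refl
        go (der ∷ ders) = +-cong (F≈G _ der) (go ders)

      total-+ : ∀ F G Ω → total (λ σ → F σ + G σ) Ω ≈ total F Ω + total G Ω
      total-+ F G []      = sym (+-identityˡ 0#)
      total-+ F G (σ ∷ Ω) = begin
        F σ + G σ + total (λ σ → F σ + G σ) Ω ≈⟨ +-congˡ (total-+ F G Ω) ⟩
        F σ + G σ + (total F Ω + total G Ω)
          ≈⟨ solve 4 (λ a b c d → a :+ b :+ (c :+ d) := a :+ c :+ (b :+ d)) refl _ _ _ _ ⟩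
        F σ + total F Ω + (G σ + total G Ω)   ∎

      total-*ʳ : ∀ F a Ω → total (λ σ → F σ * a) Ω ≈ total F Ω * a
      total-*ʳ F a []      = sym (zeroˡ a)
      total-*ʳ F a (σ ∷ Ω) = trans (+-congˡ (total-*ʳ F a Ω)) (sym (distribʳ a _ _))

      -- `G` collects the factors that are held fixed while weights are exchanged; `xs` are the
      -- letters whose hops must leave it unchanged.
      record Admissible (G : Permutation′ n → Carrier) (xs : List (Fin n)) : Set ℓ where
        field
          resp      : ∀ {σ σ′} → σ ≈ₚ σ′ → G σ ≈ G σ′
          invariant : ∀ {x σ} → x ∈ xs → Derangement σ → G (τᶜ x σ) ≈ G σ

      open Admissible

      -- Lets a letter whose weights have been replaced join `G` before the remaining letters are
      -- treated.
      admissible-letter : ∀ {G xs y q₁ q₂ d e} → Admissible G xs → (∀ {x} → x ∈ xs → y ≢ x) →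
                          Admissible (λ σ → G σ * letterAt q₁ q₂ d e σ y) xs
      admissible-letter {y = y} adm y≢ = record
        { resp      = λ {σ} {σ′} σ≈σ′ → *-cong (adm .resp σ≈σ′)
                        (reflexive (letterAt-cong σ σ′ σ≈σ′ y))
        ; invariant = λ {_} {σ} x∈ der → *-cong (adm .invariant x∈ der)
                        (reflexive (letterAt-τᶜ σ der (y≢ x∈)))
        }

      -- Lets the letters not yet treated join `G` while a single letter is treated, whose hop keeps
      -- their types.
      admissible-∏ : ∀ {G xs q₁ q₂ d e} l → Admissible G xs → (∀ {x y} → x ∈ xs → y ∈ l → y ≢ x) →
                     Admissible (λ σ → G σ * ∏ (letterAt q₁ q₂ d e σ) l) xs
      admissible-∏ l adm y≢ = record
        { resp      = λ {σ} {σ′} σ≈σ′ → *-cong (adm .resp σ≈σ′)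
                        (∏-cong l λ {y} _ → reflexive (letterAt-cong σ σ′ σ≈σ′ y))
        ; invariant = λ {_} {σ} x∈ der → *-cong (adm .invariant x∈ der)
                        (∏-cong l λ y∈ → reflexive (letterAt-τᶜ σ der (y≢ x∈ y∈)))
        }

      module _ {G : Permutation′ n → Carrier} (q₁ q₂ : Carrier) {x : Fin n} {xs : List (Fin n)}
               (adm : Admissible G (x ∷ xs)) where

        private
          ascent-part descent-part extremal-part : Permutation′ n → Carrier
          ascent-part   σ = G σ * letterAt 0# 0# 1# 0# σ x
          descent-part  σ = G σ * letterAt 0# 0# 0# 1# σ x
          extremal-part σ = G σ * letterAt q₁ q₂ 0# 0# σ x

          flipped-letter : ∀ {p s p′ s′} → Flipped p s p′ s′ →
                           letter 0# 0# 0# 1# p′ s′ ≡ letter 0# 0# 1# 0# p s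
          flipped-letter peak    = ≡.refl
          flipped-letter valley  = ≡.refl
          flipped-letter ascent  = ≡.refl
          flipped-letter descent = ≡.refl

          -- Reindexing by `τᶜ x` keeps `G` and turns the indicator of a double descent at `x` into
          -- that of a double ascent.
          ascents≈descents : total ascent-part Π ≈ total descent-part Π
          ascents≈descents = begin
            total ascent-part Π
              ≈⟨ total-cong (λ σ der → *-cong (adm .invariant (here ≡.refl) der)
                   (reflexive (flipped-letter (change-flipped
                     (Toggles.change (derangement-toggles x σ der)))))) ⟨
            total (descent-part ∘ τᶜ x) Π
              ≈⟨ total-involution
                   (λ {σ} {σ′} σ≈σ′ → *-cong (adm .resp σ≈σ′)
                     (reflexive (letterAt-cong σ σ′ σ≈σ′ x)))
                   (λ {σ} {σ′} σ≈σ′ i → ≡.cong (_⟨$⟩ʳ i) (τᶜ-cong x σ σ′ σ≈σ′))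
                   Π-unique (λ {σ} → τᶜ-closed Π-invariant x {σ})
                   (λ {σ} σ∈ → Toggles.involutive
                     (derangement-toggles x σ (derangement {σ} σ∈))) ⟩
            total descent-part Π ∎

          letter-split : ∀ d e p s → letter q₁ q₂ d e p s ≈
            letter q₁ q₂ 0# 0# p s + letter 0# 0# 1# 0# p s * d + letter 0# 0# 0# 1# p s * e
          letter-split d e true  true  =
            solve 2 (λ d e → d := con 0 :+ con 1 :* d :+ con 0 :* e) refl d e
          letter-split d e true  false =
            solve 3 (λ q d e → q := q :+ con 0 :* d :+ con 0 :* e) refl q₁ d e
          letter-split d e false true  =
            solve 3 (λ q d e → q := q :+ con 0 :* d :+ con 0 :* e) refl q₂ d e
          letter-split d e false false =
            solve 2 (λ d e → e := con 0 :+ con 0 :* d :+ con 1 :* e) refl d e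

        -- The weight of `x` is linear in `d` and `e`, with the two indicators as coefficients.
        -- Their sums against `G` agree, so only `d + e` remains.
        total-letter : ∀ d e → total (λ σ → G σ * letterAt q₁ q₂ d e σ x) Π ≈
                               total extremal-part Π + total ascent-part Π * (d + e)
        total-letter d e = begin
          total (λ σ → G σ * letterAt q₁ q₂ d e σ x) Π
            ≈⟨ total-cong (λ σ _ → trans (*-congˡ (letter-split d e (enters σ x) (leaves σ x)))
                 (solve 6 (λ g q a b d e → g :* (q :+ a :* d :+ b :* e) :=
                                           g :* q :+ g :* a :* d :+ g :* b :* e)
                   refl (G σ) _ _ _ d e)) ⟩
          total (λ σ → extremal-part σ + ascent-part σ * d + descent-part σ * e) Π
            ≈⟨ trans (total-+ _ _ Π) (+-congʳ (total-+ _ _ Π)) ⟩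
          total extremal-part Π + total (λ σ → ascent-part σ * d) Π +
          total (λ σ → descent-part σ * e) Π
            ≈⟨ +-cong (+-congˡ (total-*ʳ ascent-part d Π)) (total-*ʳ descent-part e Π) ⟩
          total extremal-part Π + total ascent-part Π * d + total descent-part Π * e
            ≈⟨ +-congˡ (*-congʳ ascents≈descents) ⟨
          total extremal-part Π + total ascent-part Π * d + total ascent-part Π * e
            ≈⟨ solve 4 (λ q a d e → q :+ a :* d :+ a :* e := q :+ a :* (d :+ e)) refl _ _ d e ⟩
          total extremal-part Π + total ascent-part Π * (d + e) ∎

      -- Replace the weights letter by letter: the sum over Π sees the two
      -- weights of a double letter only through their sum.
      total-∏-letters : ∀ q₁ q₂ {d e d′ e′} → d + e ≈ d′ + e′ →
        ∀ xs → Unique xs → ∀ G → Admissible G xs →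
        total (λ σ → G σ * ∏ (letterAt q₁ q₂ d e σ) xs) Π ≈
        total (λ σ → G σ * ∏ (letterAt q₁ q₂ d′ e′ σ) xs) Π
      total-∏-letters q₁ q₂ d+e≈ [] _ G adm = refl
      total-∏-letters q₁ q₂ {d} {e} {d′} {e′} d+e≈ (x ∷ xs) (x≢ ∷ uxs) G adm = begin
        total (λ σ → G σ * (L σ x * ∏ (L σ) xs)) Π
          ≈⟨ total-cong (λ σ _ → rotate (G σ) (L σ x) (∏ (L σ) xs)) ⟩
        total (λ σ → G σ * ∏ (L σ) xs * L σ x) Π
          ≈⟨ trans (total-letter q₁ q₂ adm-∏ d e)
               (trans (+-congˡ (*-congˡ d+e≈)) (sym (total-letter q₁ q₂ adm-∏ d′ e′))) ⟩
        total (λ σ → G σ * ∏ (L σ) xs * L′ σ x) Π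
          ≈⟨ total-cong (λ σ _ → solve 3 (λ g l p → g :* p :* l := g :* l :* p) refl
                 (G σ) (L′ σ x) (∏ (L σ) xs)) ⟩
        total (λ σ → G σ * L′ σ x * ∏ (L σ) xs) Π
          ≈⟨ total-∏-letters q₁ q₂ d+e≈ xs uxs _
               (admissible-letter adm-tail (λ y∈ → All.lookup x≢ y∈)) ⟩
        total (λ σ → G σ * L′ σ x * ∏ (L′ σ) xs) Π
          ≈⟨ total-cong (λ σ _ → *-assoc (G σ) (L′ σ x) (∏ (L′ σ) xs)) ⟩
        total (λ σ → G σ * (L′ σ x * ∏ (L′ σ) xs)) Π ∎
        where
        L L′ : Permutation′ n → Fin n → Carrier
        L  = letterAt q₁ q₂ d e
        L′ = letterAt q₁ q₂ d′ e′
        rotate : ∀ g l p → g * (l * p) ≈ g * p * l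
        rotate = solve 3 (λ g l p → g :* (l :* p) := g :* p :* l) refl
        adm-head : Admissible G (x ∷ [])
        adm-head = record { resp = adm .resp
                          ; invariant = λ { (here e) → adm .invariant (here e) } }
        adm-tail : Admissible G xs
        adm-tail = record { resp = adm .resp ; invariant = adm .invariant ∘ there }
        adm-∏ : Admissible (λ σ → G σ * ∏ (L σ) xs) (x ∷ [])
        adm-∏ = admissible-∏ xs adm-head λ { (here ≡.refl) y∈ y≡x → All.lookup x≢ y∈ (≡.sym y≡x) }

      weighted : (w q₁ q₂ d e : Carrier) → Carrier
      weighted w q₁ q₂ d e =
        total (λ σ → w ^ cyc σ * ∏ (letterAt q₁ q₂ d e σ) (allFin n)) Π

      admissible-cyc : ∀ w xs → Admissible (λ σ → w ^ cyc σ) xs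
      admissible-cyc w xs = record
        { resp      = λ {σ} {σ′} σ≈σ′ →
            reflexive (≡.cong (λ cs → w ^ length cs) (cycles-cong σ σ′ σ≈σ′))
        ; invariant = λ {x} {σ} _ der →
            reflexive (≡.cong (w ^_) (Toggles.cyc-preserved (derangement-toggles x σ der)))
        }

      weighted-double : ∀ w q₁ q₂ {d e d′ e′} → d + e ≈ d′ + e′ →
                        weighted w q₁ q₂ d e ≈ weighted w q₁ q₂ d′ e′
      weighted-double w q₁ q₂ d+e≈ = total-∏-letters q₁ q₂ d+e≈ (allFin n) (Unique.allFin⁺ n) _
        (admissible-cyc w (allFin n))

      -- `q₁` occurs once for each peak and `q₂` once for each valley; `count-peaks` makes the
      -- exponents equal.
      ∏-extremal : ∀ q₁ q₂ d e (σ : Permutation′ n) →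
        ∏ (letterAt q₁ q₂ d e σ) (allFin n) ≈
        (q₁ * q₂) ^ count (isPeak σ) (allFin n) * ∏ (letterAt 1# 1# d e σ) (allFin n)
      ∏-extremal q₁ q₂ d e σ = begin
        ∏ (letterAt q₁ q₂ d e σ) (allFin n)
          ≈⟨ ∏-cong (allFin n) (λ {y} _ → letter-factor (enters σ y) (leaves σ y)) ⟩
        ∏ (λ y → (if isPeak σ y then q₁ else 1#) * (if isValley σ y then q₂ else 1#) *
                 letterAt 1# 1# d e σ y) (allFin n)
          ≈⟨ trans (∏-* _ _ (allFin n)) (*-congʳ (∏-* _ _ (allFin n))) ⟩
        ∏ (λ y → if isPeak σ y then q₁ else 1#) (allFin n) *
        ∏ (λ y → if isValley σ y then q₂ else 1#) (allFin n) * rest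
          ≈⟨ *-congʳ (*-cong (∏-count (isPeak σ) q₁ (allFin n))
                              (∏-count (isValley σ) q₂ (allFin n))) ⟩
        q₁ ^ count (isPeak σ) (allFin n) * q₂ ^ count (isValley σ) (allFin n) * rest
          ≡⟨ ≡.cong (λ k → q₁ ^ count (isPeak σ) (allFin n) * q₂ ^ k * rest) (count-peaks σ) ⟨
        q₁ ^ count (isPeak σ) (allFin n) * q₂ ^ count (isPeak σ) (allFin n) * rest
          ≈⟨ *-congʳ (^-distrib-* q₁ q₂ (count (isPeak σ) (allFin n))) ⟨
        (q₁ * q₂) ^ count (isPeak σ) (allFin n) * rest ∎
        where
        rest = ∏ (letterAt 1# 1# d e σ) (allFin n)
        letter-factor : ∀ p s → letter q₁ q₂ d e p s ≈
          (if p ∧ not s then q₁ else 1#) * (if s ∧ not p then q₂ else 1#) * letter 1# 1# d e p s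
        letter-factor true  true  = solve 1 (λ a → a := con 1 :* con 1 :* a) refl d
        letter-factor true  false = solve 1 (λ a → a := a :* con 1 :* con 1) refl q₁
        letter-factor false true  = solve 1 (λ a → a := con 1 :* a :* con 1) refl q₂
        letter-factor false false = solve 1 (λ a → a := con 1 :* con 1 :* a) refl e

      weighted-cong : ∀ w {q₁ q₂ d e q₁′ q₂′ d′ e′} → q₁ * q₂ ≈ q₁′ * q₂′ → d + e ≈ d′ + e′ →
                      weighted w q₁ q₂ d e ≈ weighted w q₁′ q₂′ d′ e′
      weighted-cong w {q₁} {q₂} {d} {e} {q₁′} {q₂′} {d′} {e′} q≈ d+e≈ =
        trans (total-cong λ σ _ → *-congˡ (begin
            ∏ (letterAt q₁ q₂ d e σ) (allFin n)
              ≈⟨ ∏-extremal q₁ q₂ d e σ ⟩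
            _ ≈⟨ *-congʳ (^-congˡ (count (isPeak σ) (allFin n)) q≈) ⟩
            _ ≈⟨ ∏-extremal q₁′ q₂′ d e σ ⟨
            ∏ (letterAt q₁′ q₂′ d e σ) (allFin n) ∎))
          (weighted-double w q₁′ q₂′ d+e≈)

      -- The excedances are the valleys and the double ascents, the two types that receive `t`.
      A-weighted : ∀ w t → A Π w t ≈ weighted w 1# t t 1#
      A-weighted w t = total-cong λ σ _ → *-congˡ (begin
        t ^ exc σ                                            ≡⟨ ≡.cong (t ^_) (exc-count σ) ⟩
        t ^ count (leaves σ) (allFin n)                      ≈⟨ ∏-count (leaves σ) t (allFin n) ⟨
        ∏ (λ y → if leaves σ y then t else 1#) (allFin n)
          ≈⟨ ∏-cong (allFin n) (λ {y} _ → leaves-letter (enters σ y) (leaves σ y)) ⟩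
        ∏ (letterAt 1# t t 1# σ) (allFin n)                  ∎)
        where
        leaves-letter : ∀ p s → (if s then t else 1#) ≈ letter 1# t t 1# p s
        leaves-letter true  true  = refl
        leaves-letter true  false = refl
        leaves-letter false true  = refl
        leaves-letter false false = refl

      P-weighted : ∀ w x t → P (cyc ∷ cpk ∷ exc ∷ []) Π (w ∷ x ∷ t ∷ []) ≈ weighted w x t t 1#
      P-weighted w x t = total-cong λ σ der → *-congˡ (begin
        x ^ cpk σ * (t ^ exc σ * 1#)
          ≈⟨ *-congˡ (*-identityʳ _) ⟩
        x ^ cpk σ * t ^ exc σ
          ≡⟨ ≡.cong₂ (λ k j → x ^ k * t ^ j) (cpk-count {σ = σ} der) (exc-count σ) ⟩
        x ^ count (isPeak σ) (allFin n) * t ^ count (leaves σ) (allFin n)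
          ≈⟨ *-cong (∏-count (isPeak σ) x (allFin n)) (∏-count (leaves σ) t (allFin n)) ⟨
        ∏ (λ y → if isPeak σ y then x else 1#) (allFin n) *
        ∏ (λ y → if leaves σ y then t else 1#) (allFin n)
          ≈⟨ ∏-* _ _ (allFin n) ⟨
        ∏ (λ y → (if isPeak σ y then x else 1#) * (if leaves σ y then t else 1#)) (allFin n)
          ≈⟨ ∏-cong (allFin n) (λ {y} _ → peak-letter (enters σ y) (leaves σ y)) ⟩
        ∏ (letterAt x t t 1# σ) (allFin n) ∎)
        where
        peak-letter : ∀ p s → (if p ∧ not s then x else 1#) * (if s then t else 1#) ≈
                      letter x t t 1# p s
        peak-letter true  true  = *-identityˡ t
        peak-letter true  false = *-identityʳ x
        peak-letter false true  = *-identityˡ t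
        peak-letter false false = *-identityˡ 1#

      ^-weighted : ∀ a w q₁ q₂ d e →
                   a ^ n * weighted w q₁ q₂ d e ≈ weighted w (a * q₁) (a * q₂) (a * d) (a * e)
      ^-weighted a w q₁ q₂ d e = begin
        a ^ n * weighted w q₁ q₂ d e
          ≈⟨ *-comm _ _ ⟩
        weighted w q₁ q₂ d e * a ^ n
          ≈⟨ total-*ʳ _ (a ^ n) Π ⟨
        total (λ σ → w ^ cyc σ * ∏ (letterAt q₁ q₂ d e σ) (allFin n) * a ^ n) Π
          ≈⟨ total-cong (λ σ _ → trans
               (solve 3 (λ w p a → w :* p :* a := w :* (a :* p)) refl _ _ _) (*-congˡ (scale σ))) ⟩
        weighted w (a * q₁) (a * q₂) (a * d) (a * e) ∎
        where
        scale-letter : ∀ p s → a * letter q₁ q₂ d e p s ≈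
                       letter (a * q₁) (a * q₂) (a * d) (a * e) p s
        scale-letter true  true  = refl
        scale-letter true  false = refl
        scale-letter false true  = refl
        scale-letter false false = refl
        scale : ∀ σ → a ^ n * ∏ (letterAt q₁ q₂ d e σ) (allFin n) ≈
                      ∏ (letterAt (a * q₁) (a * q₂) (a * d) (a * e) σ) (allFin n)
        scale σ = begin
          a ^ n * ∏ (letterAt q₁ q₂ d e σ) (allFin n)
            ≡⟨ ≡.cong (λ k → a ^ k * ∏ (letterAt q₁ q₂ d e σ) (allFin n))
               (length-tabulate {n = n} id) ⟨
          a ^ length (allFin n) * ∏ (letterAt q₁ q₂ d e σ) (allFin n)
            ≈⟨ *-congʳ (∏-const a (allFin n)) ⟨
          ∏ (λ _ → a) (allFin n) * ∏ (letterAt q₁ q₂ d e σ) (allFin n)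
            ≈⟨ ∏-* _ _ (allFin n) ⟨
          ∏ (λ y → a * letterAt q₁ q₂ d e σ y) (allFin n)
            ≈⟨ ∏-cong (allFin n) (λ {y} _ → scale-letter (enters σ y) (leaves σ y)) ⟩
          ∏ (letterAt (a * q₁) (a * q₂) (a * d) (a * e) σ) (allFin n) ∎

      -- The hypotheses equate the invariants of (x, t, t, 1), namely x t and t + 1, with those of
      -- (1, v, v, 1) scaled by `a`.
      P-via-A : ∀ {w x t a v} → x * t ≈ a * (a * v) → t + 1# ≈ a * v + a →
                P (cyc ∷ cpk ∷ exc ∷ []) Π (w ∷ x ∷ t ∷ []) ≈ a ^ n * A Π w v
      P-via-A {w} {x} {t} {a} {v} xt≈ t+1≈ = begin
        P (cyc ∷ cpk ∷ exc ∷ []) Π (w ∷ x ∷ t ∷ [])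
          ≈⟨ P-weighted w x t ⟩
        weighted w x t t 1#
          ≈⟨ weighted-cong w (trans xt≈ (sym (*-congʳ (*-identityʳ a))))
               (trans t+1≈ (+-congˡ (sym (*-identityʳ a)))) ⟩
        weighted w (a * 1#) (a * v) (a * v) (a * 1#)
          ≈⟨ ^-weighted a w 1# v v 1# ⟨
        a ^ n * weighted w 1# v v 1#
          ≈⟨ *-congˡ (A-weighted w v) ⟨
        a ^ n * A Π w v ∎

      A-via-P : ∀ {w x t a v} → v ≈ a * x * (a * t) → v + 1# ≈ a * t + a →
                A Π w v ≈ a ^ n * P (cyc ∷ cpk ∷ exc ∷ []) Π (w ∷ x ∷ t ∷ [])
      A-via-P {w} {x} {t} {a} {v} v≈ v+1≈ = begin
        A Π w v
          ≈⟨ A-weighted w v ⟩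
        weighted w 1# v v 1#
          ≈⟨ weighted-cong w (trans (*-identityˡ v) v≈)
               (trans v+1≈ (+-congˡ (sym (*-identityʳ a)))) ⟩
        weighted w (a * x) (a * t) (a * t) (a * 1#)
          ≈⟨ ^-weighted a w x t t 1# ⟨
        a ^ n * weighted w x t t 1#
          ≈⟨ *-congˡ (P-weighted w x t) ⟨
        a ^ n * P (cyc ∷ cpk ∷ exc ∷ []) Π (w ∷ x ∷ t ∷ []) ∎

open import Defs
open import Algebra.Bundles using (CommutativeRing)
open import Data.Fin.Permutation using (Permutation′)
open import Data.List.Base using (List)
open import Data.List.Relation.Unary.All using (All)
open import Data.Nat.Base using (ℕ; _≥_)
open import Data.Vec.Base using ([]; _∷_)
open import Data.Product.Base using (_×_; _,_; proj₁; proj₂)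
open WeightedSums

-- The algebra of the two substitutions.

module Substitutions {c ℓ} (R : CommutativeRing c ℓ) where
  open CommutativeRing R
  open Enumerators R
  open import Relation.Binary.Reasoning.Setoid setoid
  open import Algebra.Properties.AbelianGroup +-abelianGroup using (∙-cancelʳ)
  open import Algebra.Solver.Ring.NaturalCoefficients.Default commutativeSemiring
    using (Polynomial; solve; _:=_; _:+_; _:*_; con)

  private
    :1 :2 :4 : ∀ {m} → Polynomial m
    :1 = con 1
    :2 = :1 :+ :1
    :4 = :2 :+ :2

    -- Copies the unfolding of `_^ 2`, so that the solver's polynomials evaluate to the expressions
    -- in the goals.
    infixl 9 _²
    _² : ∀ {m} → Polynomial m → Polynomial m
    p ² = p :* (p :* :1)

    -- The semiring solver knows no subtraction. Differences are passed to it as atoms; the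
    -- subtracted terms are added on both sides, absorbed by this lemma or the next, and cancelled
    -- at the end.
    minus-plus : ∀ p q → p - q + q ≈ p
    minus-plus p q = trans (+-assoc p (- q) q) (trans (+-congˡ (-‿inverseˡ q)) (+-identityʳ p))

    minus-minus-plus : ∀ p q r → p - q - r + (q + r) ≈ p
    minus-minus-plus p q r = begin
      p - q - r + (q + r)
        ≈⟨ solve 4 (λ a r′ q r → a :+ r′ :+ (q :+ r) :=
             a :+ (r′ :+ r) :+ q) refl (p - q) (- r) q r ⟩
      p - q + (- r + r) + q ≈⟨ +-congʳ (trans (+-congˡ (-‿inverseˡ r)) (+-identityʳ _)) ⟩
      p - q + q ≈⟨ minus-plus p q ⟩
      p ∎

  module _ (x t : Carrier) {i j k : Carrier} (i-inverse : (1# + x) * i ≈ 1#)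
           (j-inverse : (1# + x * t) * j ≈ 1#)
           (k-inverse : (x + t) * (1# + x * t) * k ≈ 1#) where

    private
      scale = (1# + x * t) * i
      X     = (1# + x) ^ 2 * t * k
      T     = (x + t) * j

      scale*T : scale * T ≈ i * (x + t)
      scale*T = begin
        (1# + x * t) * i * ((x + t) * j)
          ≈⟨ solve 4 (λ i x t j → (:1 :+ x :* t) :* i :* ((x :+ t) :* j) :=
               (:1 :+ x :* t) :* j :* (i :* (x :+ t))) refl i x t j ⟩
        (1# + x * t) * j * (i * (x + t)) ≈⟨ *-congʳ j-inverse ⟩
        1# * (i * (x + t))               ≈⟨ *-identityˡ _ ⟩
        i * (x + t)                      ∎

    -- `scale * T` is (x + t) / (1 + x) and `scale * X` is (1 + x) t / (x + t), so everything but
    -- `t` cancels.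
    product₁ : t ≈ scale * X * (scale * T)
    product₁ = sym (begin
      scale * X * (scale * T) ≈⟨ *-congˡ scale*T ⟩
      scale * X * (i * (x + t))
        ≈⟨ solve 4 (λ i x t k →
             (:1 :+ x :* t) :* i :* ((:1 :+ x) ² :* t :* k) :* (i :* (x :+ t)) :=
             (x :+ t) :* (:1 :+ x :* t) :* k :* ((:1 :+ x) :* i :* ((:1 :+ x) :* i)) :* t)
             refl i x t k ⟩
      (x + t) * (1# + x * t) * k * ((1# + x) * i * ((1# + x) * i)) * t
        ≈⟨ *-congʳ (*-cong k-inverse (*-cong i-inverse i-inverse)) ⟩
      1# * (1# * 1#) * t
        ≈⟨ solve 1 (λ t → :1 :* (:1 :* :1) :* t := t) refl t ⟩
      t ∎)

    sum₁ : t + 1# ≈ scale * T + scale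
    sum₁ = sym (begin
      scale * T + scale ≈⟨ +-congʳ scale*T ⟩
      i * (x + t) + (1# + x * t) * i
        ≈⟨ solve 3 (λ i x t → i :* (x :+ t) :+ (:1 :+ x :* t) :* i :=
             (:1 :+ x) :* i :* (t :+ :1)) refl i x t ⟩
      (1# + x) * i * (t + 1#) ≈⟨ *-congʳ i-inverse ⟩
      1# * (t + 1#)           ≈⟨ *-identityˡ _ ⟩
      t + 1#                  ∎)

  -- With k = 1 + t − s and h = s + t − 1, and a, b the denominators and
  -- N₁, N₂ the numerators of u and v, the relations are
  --   a + N₁ = s h,  b + N₂ = (1 + t) k,  2 N₂ = k²,  a b + N₁ N₂ = s h k.
  module _ (x t s : Carrier) (s²≈ : s ^ 2 ≈ (1# + t) ^ 2 - 4# * x * t) where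

    private
      a = 2# * (1# - x) * t
      b = 2# * x * t
      N₁ = 1# + t ^ 2 - 2# * x * t - (1# - t) * s
      N₂ = (1# + t) ^ 2 - 2# * x * t - (1# + t) * s
      k = 1# + t - s
      h = s + t - 1#

      discriminant : s ^ 2 + 4# * x * t ≈ (1# + t) ^ 2
      discriminant = trans (+-congʳ s²≈) (minus-plus _ _)

      k+s : k + s ≈ 1# + t
      k+s = minus-plus _ _

      h+k : h + k ≈ 2# * t
      h+k = ∙-cancelʳ (1# + s) _ _ (begin
        h + k + (1# + s)
          ≈⟨ solve 3 (λ h k s → h :+ k :+ (:1 :+ s) :=
               (h :+ :1) :+ (k :+ s)) refl h k s ⟩
        (h + 1#) + (k + s) ≈⟨ +-cong (minus-plus _ _) k+s ⟩
        (s + t) + (1# + t)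
          ≈⟨ solve 2 (λ s t → (s :+ t) :+ (:1 :+ t) :=
               :2 :* t :+ (:1 :+ s)) refl s t ⟩
        2# * t + (1# + s)  ∎)

      h+[1-t] : h + (1# - t) ≈ s
      h+[1-t] = ∙-cancelʳ (1# + t) _ _ (begin
        h + (1# - t) + (1# + t)
          ≈⟨ solve 3 (λ h y t → h :+ y :+ (:1 :+ t) :=
               (h :+ :1) :+ (y :+ t)) refl h (1# - t) t ⟩
        (h + 1#) + (1# - t + t) ≈⟨ +-cong (minus-plus _ _) (minus-plus _ _) ⟩
        (s + t) + 1#
          ≈⟨ solve 2 (λ s t → s :+ t :+ :1 :=
               s :+ (:1 :+ t)) refl s t ⟩
        s + (1# + t)            ∎)

      a+b : a + b ≈ 2# * t
      a+b = begin
        2# * (1# - x) * t + 2# * x * t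
          ≈⟨ solve 3 (λ y x t → :2 :* y :* t :+ :2 :* x :* t :=
               :2 :* (y :+ x) :* t) refl (1# - x) x t ⟩
        2# * (1# - x + x) * t ≈⟨ *-congʳ (*-congˡ (minus-plus _ _)) ⟩
        2# * 1# * t           ≈⟨ *-congʳ (*-identityʳ _) ⟩
        2# * t                ∎

      b+N₂ : b + N₂ ≈ (1# + t) * k
      b+N₂ = ∙-cancelʳ ((1# + t) * s) _ _ (begin
        b + N₂ + (1# + t) * s
          ≈⟨ solve 3 (λ b N r → b :+ N :+ r := N :+ (b :+ r)) refl b N₂ ((1# + t) * s) ⟩
        N₂ + (b + (1# + t) * s) ≈⟨ minus-minus-plus _ _ _ ⟩
        (1# + t) ^ 2            ≈⟨ solve 1 (λ y → y ² := y :* y) refl (1# + t) ⟩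
        (1# + t) * (1# + t)     ≈⟨ *-congˡ k+s ⟨
        (1# + t) * (k + s)      ≈⟨ distribˡ _ _ _ ⟩
        (1# + t) * k + (1# + t) * s ∎)

      -- Trading 4 x t for (1 + t)² - s² completes the square (1 + t - s)².
      2N₂ : 2# * N₂ ≈ k * k
      2N₂ = ∙-cancelʳ (4# * x * t + 2# * ((1# + t) * s) + s ^ 2) _ _ (begin
        2# * N₂ + (4# * x * t + 2# * ((1# + t) * s) + s ^ 2)
          ≈⟨ solve 5 (λ N x t r s → :2 :* N :+ (:4 :* x :* t :+ :2 :* r :+ s ²) :=
               :2 :* (N :+ (:2 :* x :* t :+ r)) :+ s ²) refl N₂ x t ((1# + t) * s) s ⟩
        2# * (N₂ + (b + (1# + t) * s)) + s ^ 2
          ≈⟨ +-congʳ (*-congˡ (trans (minus-minus-plus _ _ _) (^-cong k+s))) ⟩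
        2# * (k + s) ^ 2 + s ^ 2
          ≈⟨ solve 2 (λ k s → :2 :* (k :+ s) ² :+ s ² :=
               k :* k :+ ((k :+ s) ² :+ :2 :* ((k :+ s) :* s))) refl k s ⟩
        k * k + ((k + s) ^ 2 + 2# * ((k + s) * s))
          ≈⟨ +-congˡ (+-cong (trans (sym (^-cong k+s)) (sym discriminant))
                     (*-congˡ (*-congʳ k+s))) ⟩
        k * k + (s ^ 2 + 4# * x * t + 2# * ((1# + t) * s))
          ≈⟨ solve 5 (λ k s x t r → k :* k :+ (s ² :+ :4 :* x :* t :+ :2 :* r) :=
               k :* k :+ (:4 :* x :* t :+ :2 :* r :+ s ²)) refl k s x t ((1# + t) * s) ⟩
        k * k + (4# * x * t + 2# * ((1# + t) * s) + s ^ 2) ∎)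
        where
        ^-cong : ∀ {p q} → p ≈ q → q ^ 2 ≈ p ^ 2
        ^-cong p≈q = *-cong (sym p≈q) (*-congʳ (sym p≈q))

      a+N₁ : a + N₁ ≈ s * h
      a+N₁ = ∙-cancelʳ (4# * x * t + (1# - t) * s) _ _ (begin
        a + N₁ + (4# * x * t + (1# - t) * s)
          ≈⟨ solve 5 (λ a N x t r → a :+ N :+ (:4 :* x :* t :+ r) :=
               (a :+ :2 :* x :* t) :+ (N :+ (:2 :* x :* t :+ r)))
               refl a N₁ x t ((1# - t) * s) ⟩
        (a + b) + (N₁ + (b + (1# - t) * s)) ≈⟨ +-cong a+b (minus-minus-plus _ _ _) ⟩
        2# * t + (1# + t ^ 2)
          ≈⟨ solve 1 (λ t → :2 :* t :+ (:1 :+ t ²) :=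
               (:1 :+ t) ²) refl t ⟩
        (1# + t) ^ 2          ≈⟨ discriminant ⟨
        s ^ 2 + 4# * x * t    ≈⟨ +-congʳ (*-congˡ (trans (*-identityʳ s) (sym h+[1-t]))) ⟩
        s * (h + (1# - t)) + 4# * x * t
          ≈⟨ solve 5 (λ s h y x t → s :* (h :+ y) :+ :4 :* x :* t :=
               s :* h :+ (:4 :* x :* t :+ y :* s)) refl s h (1# - t) x t ⟩
        s * h + (4# * x * t + (1# - t) * s) ∎)

      -- The cofactor of `s` in `ab+N₁N₂`. Adding `k * (b + N₂)` brings in `a + b` and `h + k`, both
      -- equal to 2 t.
      ak+hN₂ : a * k + h * N₂ ≈ h * k
      ak+hN₂ = ∙-cancelʳ (k * (b + N₂)) _ _ (begin
        a * k + h * N₂ + k * (b + N₂)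
          ≈⟨ solve 5 (λ a b h k N → a :* k :+ h :* N :+ k :* (b :+ N) :=
               (a :+ b) :* k :+ (h :+ k) :* N) refl a b h k N₂ ⟩
        (a + b) * k + (h + k) * N₂ ≈⟨ +-cong (*-congʳ a+b) (*-congʳ h+k) ⟩
        2# * t * k + 2# * t * N₂
          ≈⟨ solve 3 (λ t k N → :2 :* t :* k :+ :2 :* t :* N :=
               :2 :* t :* k :+ t :* (:2 :* N)) refl t k N₂ ⟩
        2# * t * k + t * (2# * N₂) ≈⟨ +-cong (*-congʳ (sym h+k)) (*-congˡ 2N₂) ⟩
        (h + k) * k + t * (k * k)
          ≈⟨ solve 3 (λ t h k → (h :+ k) :* k :+ t :* (k :* k) :=
               h :* k :+ k :* ((:1 :+ t) :* k)) refl t h k ⟩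
        h * k + k * ((1# + t) * k) ≈⟨ +-congˡ (*-congˡ b+N₂) ⟨
        h * k + k * (b + N₂) ∎)

      -- Regrouped as a (b + N₂) + (a + N₁) N₂ - 2 a N₂: the first and last terms combine to a k (1
      -- + t - k) = a k s, so that `s` factors out.
      ab+N₁N₂ : a * b + N₁ * N₂ ≈ s * h * k
      ab+N₁N₂ = ∙-cancelʳ (2# * (a * N₂)) _ _ (begin
        a * b + N₁ * N₂ + 2# * (a * N₂)
          ≈⟨ solve 4 (λ a b M N → a :* b :+ M :* N :+ :2 :* (a :* N) :=
               a :* (b :+ N) :+ (a :+ M) :* N) refl a b N₁ N₂ ⟩
        a * (b + N₂) + (a + N₁) * N₂
          ≈⟨ +-cong (*-congˡ (trans b+N₂ (*-congʳ (sym k+s)))) (*-congʳ a+N₁) ⟩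
        a * ((k + s) * k) + s * h * N₂
          ≈⟨ solve 5 (λ a k s h N → a :* ((k :+ s) :* k) :+ s :* h :* N :=
               s :* (a :* k :+ h :* N) :+ a :* (k :* k)) refl a k s h N₂ ⟩
        s * (a * k + h * N₂) + a * (k * k)
          ≈⟨ +-cong (*-congˡ ak+hN₂) (*-congˡ (sym 2N₂)) ⟩
        s * (h * k) + a * (2# * N₂)
          ≈⟨ solve 5 (λ s h k a N → s :* (h :* k) :+ a :* (:2 :* N) :=
               s :* h :* k :+ :2 :* (a :* N)) refl s h k a N₂ ⟩
        s * h * k + 2# * (a * N₂) ∎)

    module _ {i j : Carrier} (i-inverse : a * i ≈ 1#) (j-inverse : b * j ≈ 1#) where

      private
        u = N₁ * i
        v = N₂ * j

        1+u : 1# + u ≈ s * h * i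
        1+u = begin
          1# + N₁ * i    ≈⟨ +-congʳ i-inverse ⟨
          a * i + N₁ * i ≈⟨ distribʳ _ _ _ ⟨
          (a + N₁) * i   ≈⟨ *-congʳ a+N₁ ⟩
          s * h * i      ∎

        1+v : 1# + v ≈ (1# + t) * k * j
        1+v = begin
          1# + N₂ * j      ≈⟨ +-congʳ j-inverse ⟨
          b * j + N₂ * j   ≈⟨ distribʳ _ _ _ ⟨
          (b + N₂) * j     ≈⟨ *-congʳ b+N₂ ⟩
          (1# + t) * k * j ∎

        1+uv : 1# + u * v ≈ s * h * i * (k * j)
        1+uv = begin
          1# + u * v
            ≈⟨ +-congʳ (trans (sym (*-identityˡ 1#)) (*-cong (sym i-inverse) (sym j-inverse))) ⟩
          a * i * (b * j) + N₁ * i * (N₂ * j)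
            ≈⟨ solve 6 (λ a b i j M N → a :* i :* (b :* j) :+ M :* i :* (N :* j) :=
                 (a :* b :+ M :* N) :* (i :* j)) refl a b i j N₁ N₂ ⟩
          (a * b + N₁ * N₂) * (i * j) ≈⟨ *-congʳ ab+N₁N₂ ⟩
          s * h * k * (i * j)
            ≈⟨ solve 4 (λ p k i j → p :* k :* (i :* j) :=
                 p :* i :* (k :* j)) refl (s * h) k i j ⟩
          s * h * i * (k * j) ∎

        -- Multiplying by `b * j`, which is 1, supplies both x t and the factor 2 that `2N₂` asks
        -- for, so that nothing has to be halved.
        v-square : v ≈ x * t * (k * j * (k * j))
        v-square = begin
          N₂ * j               ≈⟨ *-identityˡ _ ⟨
          1# * (N₂ * j)        ≈⟨ *-congʳ j-inverse ⟨
          b * j * (N₂ * j)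
            ≈⟨ solve 4 (λ x t j N → :2 :* x :* t :* j :* (N :* j) :=
                 x :* t :* (:2 :* N :* (j :* j))) refl x t j N₂ ⟩
          x * t * (2# * N₂ * (j * j)) ≈⟨ *-congˡ (*-congʳ 2N₂) ⟩
          x * t * (k * k * (j * j))
            ≈⟨ solve 4 (λ x t k j → x :* t :* (k :* k :* (j :* j)) :=
                 x :* t :* (k :* j :* (k :* j))) refl x t k j ⟩
          x * t * (k * j * (k * j)) ∎

      module _ {g : Carrier} (g-inverse : (1# + u * v) * g ≈ 1#) where

        private
          scale = (1# + u) * g

          -- 1 + u v equals (1 + u) k / b, so its inverse `g` cancels 1 + u as well and `scale` is b
          -- / k.
          scale*kj : scale * (k * j) ≈ 1#
          scale*kj = begin
            (1# + u) * g * (k * j) ≈⟨ *-congʳ (*-congʳ 1+u) ⟩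
            s * h * i * g * (k * j)
              ≈⟨ solve 3 (λ p g q → p :* g :* q := p :* q :* g) refl (s * h * i) g (k * j) ⟩
            s * h * i * (k * j) * g ≈⟨ *-congʳ 1+uv ⟨
            (1# + u * v) * g        ≈⟨ g-inverse ⟩
            1#                      ∎

        product₂ : x * t ≈ scale * (scale * v)
        product₂ = sym (begin
          scale * (scale * v) ≈⟨ *-congˡ (*-congˡ v-square) ⟩
          scale * (scale * (x * t * (k * j * (k * j))))
            ≈⟨ solve 3 (λ c y q → c :* (c :* (y :* (q :* q))) :=
                 y :* (c :* q :* (c :* q))) refl scale (x * t) (k * j) ⟩
          x * t * (scale * (k * j) * (scale * (k * j)))
            ≈⟨ *-congˡ (trans (*-cong scale*kj scale*kj) (*-identityˡ 1#)) ⟩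
          x * t * 1# ≈⟨ *-identityʳ _ ⟩
          x * t      ∎)

        sum₂ : t + 1# ≈ scale * v + scale
        sum₂ = sym (begin
          scale * v + scale
            ≈⟨ solve 2 (λ c v → c :* v :+ c := c :* (:1 :+ v)) refl scale v ⟩
          scale * (1# + v) ≈⟨ *-congˡ 1+v ⟩
          scale * ((1# + t) * k * j)
            ≈⟨ solve 4 (λ c t k j → c :* ((:1 :+ t) :* k :* j) :=
                 c :* (k :* j) :* (t :+ :1)) refl scale t k j ⟩
          scale * (k * j) * (t + 1#) ≈⟨ *-congʳ scale*kj ⟩
          1# * (t + 1#)              ≈⟨ *-identityˡ _ ⟩
          t + 1#                     ∎)

theorem4p2 :
  ∀ (n : ℕ) → n ≥ 1 →
  (Π : List (Permutation′ n)) → Unique Π → All Derangement Π →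
  CMFS-Invariant Π →
  ∀ {c ℓ} (R : CommutativeRing c ℓ) →
  let open CommutativeRing R
      open Enumerators R
  in
  (∀ (w x t : Carrier) →
    ⦃ _ : Unit (1# + x) ⦄ ⦃ _ : Unit (1# + x * t) ⦄
    ⦃ _ : Unit ((x + t) * (1# + x * t)) ⦄ →
    A Π w t
      ≈ ((1# + x * t) / (1# + x)) ^ n
        * P (cyc ∷ cpk ∷ exc ∷ []) Π
            ( w
            ∷ (1# + x) ^ 2 * t / ((x + t) * (1# + x * t))
            ∷ (x + t) / (1# + x * t)
            ∷ [] ))
  ×
  (∀ (w x t s : Carrier) →
    s ^ 2 ≈ (1# + t) ^ 2 - 4# * x * t →
    ⦃ _ : Unit (2# * (1# - x) * t) ⦄ ⦃ _ : Unit (2# * x * t) ⦄ →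
    let u = (1# + t ^ 2 - 2# * x * t - (1# - t) * s)
              / (2# * (1# - x) * t)
        v = ((1# + t) ^ 2 - 2# * x * t - (1# + t) * s)
              / (2# * x * t)
    in
    ⦃ _ : Unit (1# + u * v) ⦄ →
    P (cyc ∷ cpk ∷ exc ∷ []) Π (w ∷ x ∷ t ∷ [])
      ≈ ((1# + u) / (1# + u * v)) ^ n * A Π w v)
theorem4p2 n _ Π Π-unique Π-derangements Π-invariant R =
  (λ w x t ⦃ i ⦄ ⦃ j ⦄ ⦃ k ⦄ →
    A-via-P (product₁ x t (inverse i) (inverse j) (inverse k))
            (sum₁ x t (inverse i) (inverse j) (inverse k))) ,
  (λ w x t s s²≈ ⦃ i ⦄ ⦃ j ⦄ ⦃ g ⦄ →
    P-via-A (product₂ x t s s²≈ (inverse i) (inverse j) (inverse g))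
            (sum₂ x t s s²≈ (inverse i) (inverse j) (inverse g)))
  where
  open CommutativeRing R using (_≈_; _*_; 1#)
  open Enumerators R using (Unit)
  open Substitutions R
  open Weights.Chain R Π Π-unique Π-derangements Π-invariant
  inverse : ∀ {a} (unit : Unit a) → a * proj₁ unit ≈ 1#
  inverse unit = proj₂ (proj₂ unit)
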